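{- Let $n \ge 4$ be an even integer. Then ${\sf E}(D_{2n} \times C_2) = 5n + 1$ and ${\sf d}(D_{2n} \times C_2) = n + 1$. In particular, ${\sf E}(D_{2n} \times C_2) = {\sf d}(D_{2n} \times C_2) + |D_{2n} \times C_2|$.
   Context: $D_{2n}$ is the dihedral group of order $2n$ and $C_2$ the cyclic group of order $2$. For a finite group $G$, a sequence over $G$ is a finite unordered list of elements of $G$ with repetitions allowed; for $S = g_1\cdots g_k$, $\pi(S)$ is the set of all products $g_{\tau(1)}\cdots g_{\tau(k)}$ over permutations $\tau$. A sequence is product-one free if no non-empty subsequence $T$ has $1 \in \pi(T)$. ${\sf d}(G)$ is the maximum length of a product-one free sequence over $G$. ${\sf E}(G)$ is the smallest $\ell>0$ such that every sequence over $G$ of length at least $\ell$ has a subsequence $T$ of length $|G|$ with $1 \in \pi(T)$. -}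

module Defs where

open import Data.Nat using (ℕ; zero; suc; _+_; _∸_; _≤_; _<_; NonZero; >-nonZero⁻¹)
open import Data.Nat.DivMod using (_%_; m%n<n)
open import Data.Fin using (Fin; toℕ; fromℕ<)
open import Data.Bool using (Bool; true; false; _xor_; if_then_else_)
open import Data.Product using (_×_; _,_; ∃; Σ-syntax)
open import Data.List using (List; length; foldr)
open import Data.List.Relation.Binary.Sublist.Propositional using (_⊆_)
open import Data.List.Relation.Binary.Permutation.Propositional using (_↭_)
open import Relation.Binary.PropositionalEquality using (_≡_)
open import Relation.Nullary using (¬_)

-- Zero-sum notions for a finite group given by carrier, product, unit.
-- Sequences are lists (considered up to reordering via _↭_ where needed);
-- subsequences are sublists.

module ZeroSum {A : Set} (_∙_ : A → A → A) (ε : A) where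

  prod : List A → A
  prod = foldr _∙_ ε

  OneInπ : List A → Set
  OneInπ T = ∃ λ T′ → (T′ ↭ T) × (prod T′ ≡ ε)

  NonEmpty : List A → Set
  NonEmpty T = 1 ≤ length T

  ProductOneFree : List A → Set
  ProductOneFree S = ¬ (∃ λ T → (T ⊆ S) × NonEmpty T × OneInπ T)

  IsD : ℕ → Set
  IsD ℓ = (∃ λ S → ProductOneFree S × (length S ≡ ℓ))
        × (∀ S → ProductOneFree S → length S ≤ ℓ)

  EProp : ℕ → ℕ → Set
  EProp order ℓ = ∀ S → ℓ ≤ length S →
    ∃ λ T → (T ⊆ S) × (length T ≡ order) × OneInπ T

  IsE : ℕ → ℕ → Set
  IsE order ℓ = (0 < ℓ) × EProp order ℓ
              × (∀ m → 0 < m → EProp order m → ℓ ≤ m)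

-- The group D_{2n} × C₂.
-- Element (a , s , c) represents (x^a y^s , z^c) where
-- D_{2n} = ⟨x, y ∣ x^n = y^2 = 1, y x y⁻¹ = x⁻¹⟩ and C₂ = ⟨z⟩.
-- Hence (x^a y^s)(x^b y^t) = x^(a + (-1)^s b) y^(s xor t).

module Dihedral (n : ℕ) .{{_ : NonZero n}} where

  Zn : Set
  Zn = Fin n

  mod : ℕ → Zn
  mod m = fromℕ< (m%n<n m n)

  _⊕_ : Zn → Zn → Zn
  a ⊕ b = mod (toℕ a + toℕ b)

  ⊖_ : Zn → Zn
  ⊖ b = mod (n ∸ toℕ b)

  G : Set
  G = Zn × Bool × Bool

  _·_ : G → G → G
  (a , s , c) · (b , t , d) = (a ⊕ (if s then ⊖ b else b)) , (s xor t) , (c xor d)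

  e : G
  e = mod 0 , false , false

  open ZeroSum _·_ e public

{-# OPTIONS --safe #-}

-- Write n = 2m. Modulo ⟨x²⟩ ≅ C_m the group is F₂³, so two elements of the same
-- class multiply into ⟨x²⟩, as do four distinct classes forming an affine plane.
-- Pair off a sequence of length 10m + 1 inside the eight classes; an odd number
-- of classes is left with one unpaired element each.
--   * At most three: there are 5m - 1 pairs, and the Erdős–Ginzburg–Ziv theorem
--     in C_m, applied four times, gives 4m pairs with product 1.
--   * Five: four of them form a plane; EGZ with one item of weight two suffices.
--   * Seven: let p be a prime factor of m. A plane of two rotations and two
--     reflections takes several values, depending on the order of its factors.
--     Two values that differ mod p replace one missing pair. Otherwise p is odd,
--     the plane has value 0, and inverting rotations between two reflections
--     gives the signs needed to find p pairs' worth of elements with product in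
--     ⟨x^2p⟩. These blocks are then handled by EGZ in C_(m/p).
-- The sums mod p are controlled by the elementary fact that adding a slot with
-- two incongruent choices enlarges the set of sums until it is everything.
-- The bound for d and the lower bound for E follow by appending 4n - 1 copies of
-- the identity, and from the free sequence y, z, x, …, x of length n + 1.
module Submission where

open import Defs
open import Data.Nat as ℕ using (ℕ; zero; suc; 2+; _≤_; _<_; z≤n; s≤s)
import Data.Nat.Divisibility as ℕ
import Data.Nat.DivMod as ℕ
open import Data.Nat.ListAction using (product)
open import Data.Nat.Primality using (Prime; euclidsLemma; prime⇒nonZero; ¬prime[0]; ¬prime[1])
open import Data.Nat.Primality.Factorisation using (PrimeFactorisation; factorise)
import Data.Nat.Properties as ℕ
open import Data.Nat.Tactic.RingSolver using () renaming (solve-∀ to ℕ-solve-∀)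
open import Data.Integer as ℤ using (ℤ; +_; 0ℤ; 1ℤ; _+_; _-_; _*_; -_)
open import Data.Integer.DivMod using (_%ℕ_; _/ℕ_; n%ℕd<d; a≡a%ℕn+[a/ℕn]*n)
open import Data.Integer.Divisibility.Signed using
  (_∣_; divides; _∣?_; ∣⇒∣ᵤ; ∣ᵤ⇒∣; ∣-refl; ∣m∣n⇒∣m+n; ∣m⇒∣-m; ∣m⇒∣m*n)
import Data.Integer.Properties as ℤ
open import Data.Integer.Tactic.RingSolver using (solve-∀)
open import Data.Bool using (Bool; true; false; if_then_else_; not; _xor_)
import Data.Bool.Properties as Bool
open import Data.Empty using (⊥; ⊥-elim)
open import Data.Fin as Fin using (Fin; toℕ; fromℕ<)
import Data.Fin.Properties as Fin
open import Data.Maybe using (Maybe; just; nothing; maybe)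
open import Data.Product using (_×_; _,_; ∃; ∃₂; proj₁; proj₂)
open import Data.Sum using (_⊎_; inj₁; inj₂; [_,_]′)
open import Data.List using
  (List; []; _∷_; _++_; length; map; foldr; concatMap; lookup; catMaybes; replicate)
open import Data.List.Properties using
  ( length-++; length-map; length-replicate; map-∘; map-cong; map-id; map-++; ++-assoc; ++-identityʳ
  ; concatMap-++; concatMap-map; concatMap-pure; catMaybes-++; mapMaybe-just; ∷-injectiveˡ; ∷-injectiveʳ)
  renaming (≡-dec to ≡-decᴸ)
import Data.List.Membership.DecPropositional as DecMembership
open import Data.List.Membership.Propositional using (_∈_; find; lose)
open import Data.List.Membership.Propositional.Properties using (∈-lookup; ∈-++⁻; ∈-∃++)
open import Data.List.Relation.Unary.All as All using (All; []; _∷_)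
import Data.List.Relation.Unary.All.Properties as All
open import Data.List.Relation.Unary.AllPairs as AllPairs using (AllPairs; []; _∷_)
import Data.List.Relation.Unary.AllPairs.Properties as AllPairs
open import Data.List.Relation.Unary.Any as Any using (Any; here; there)
import Data.List.Relation.Unary.Any.Properties as Any
open import Data.List.Relation.Binary.Permutation.Propositional as Perm using
  (_↭_; prep; swap; ↭-refl; ↭-sym; ↭-trans; ↭-reflexive; module PermutationReasoning)
open import Data.List.Relation.Binary.Permutation.Propositional.Properties using
  ( ++⁺; ++⁺ˡ; ++⁺ʳ; ++-comm; shift; shifts; drop-∷; map⁺; catMaybes-↭; ↭-length; ↭-map-inv
  ; ++-commutativeMonoid; All-resp-↭; ∈-resp-↭)
open import Data.List.Relation.Binary.Sublist.Propositional using (_⊆_; []; _∷_; _∷ʳ_; ⊆-refl)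
open import Data.List.Relation.Binary.Sublist.Propositional.Properties as Sublist using (All-resp-⊆; length-mono-≤)
open import Function using (_∘_; case_of_)
open import Relation.Binary using (DecidableEquality)
open import Relation.Binary.PropositionalEquality hiding ([_]; J)
open import Relation.Nullary using (¬_; Dec; yes; no; ¬?; _×-dec_)
open import Relation.Nullary.Decidable using (map′; decidable-stable; from-yes; _→-dec_)

import Algebra.Solver.CommutativeMonoid as CMSolver
module ↭-Solver {A : Set} = CMSolver (++-commutativeMonoid {A = A})

-- Call half the length of a product its weight. The target is weight 4m = 2n, made of four pieces
-- of weight m with product in ⟨x^(2m)⟩; a pair weighs one and a plane of four classes weighs two.
-- With five unpaired classes, pairs and plane together still weigh 5m, but with seven they weigh
-- only (5m - 3) + 2 = 5m - 1. A plane of fixed value may then be useless: for m = p, once three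
-- blocks are removed, there can be p - 1 pairs of value 0, p - 2 pairs of value 1 and a plane of
-- value 1, and no selection of weight p has sum divisible by p. So the order of the factors must be
-- exploited. This is done modulo a prime, where sums of free choices are easy to count, and only
-- once: a single additional block of weight p brings their number to the 5m/p - 1 that four uses of
-- EGZ in C_(m/p) require. Products are computed in D∞ × C₂, with integer exponents, so that a value
-- divisible by p can be divided by p and tested again; reduction modulo n comes only at the end.

private variable
  I J : Set

infix 4 _≈_[_]

-- Sums over lists, and lists up to permutation

Σ[_]_ : (I → ℤ) → List I → ℤ
Σ[ v ] xs = foldr (λ x s → v x + s) 0ℤ xs

Σ-++ : (v : I → ℤ) (xs ys : List I) → Σ[ v ] (xs ++ ys) ≡ Σ[ v ] xs + Σ[ v ] ys
Σ-++ v []       ys = sym (ℤ.+-identityˡ _)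
Σ-++ v (x ∷ xs) ys = trans (cong (_+_ (v x)) (Σ-++ v xs ys)) (sym (ℤ.+-assoc (v x) _ _))

Σ-↭ : (v : I → ℤ) {xs ys : List I} → xs ↭ ys → Σ[ v ] xs ≡ Σ[ v ] ys
Σ-↭ v Perm.refl         = refl
Σ-↭ v (prep x p)   = cong (_+_ (v x)) (Σ-↭ v p)
Σ-↭ v (swap x y p) rewrite Σ-↭ v p = lem (v x) (v y) _
  where
  lem : ∀ a b c → a + (b + c) ≡ b + (a + c)
  lem = solve-∀
Σ-↭ v (Perm.trans p q)  = trans (Σ-↭ v p) (Σ-↭ v q)

Σ-map : (v : J → ℤ) (f : I → J) (xs : List I) → Σ[ v ] map f xs ≡ Σ[ v ∘ f ] xs
Σ-map v f []       = refl
Σ-map v f (x ∷ xs) = cong (_+_ (v (f x))) (Σ-map v f xs)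

Σ-cong : {v w : I → ℤ} → (∀ x → v x ≡ w x) → ∀ xs → Σ[ v ] xs ≡ Σ[ w ] xs
Σ-cong e []       = refl
Σ-cong e (x ∷ xs) = cong₂ _+_ (e x) (Σ-cong e xs)

Σ-concatMap : (v : J → ℤ) (f : I → List J) (xs : List I) →
  Σ[ v ] concatMap f xs ≡ Σ[ (λ x → Σ[ v ] f x) ] xs
Σ-concatMap v f []       = refl
Σ-concatMap v f (x ∷ xs) = trans (Σ-++ v (f x) _) (cong (_+_ (Σ[ v ] f x)) (Σ-concatMap v f xs))

Σ-*ʳ : (v : I → ℤ) (c : ℤ) (xs : List I) → Σ[ (λ x → v x * c) ] xs ≡ (Σ[ v ] xs) * c
Σ-*ʳ v c []       = refl
Σ-*ʳ v c (x ∷ xs) = trans (cong (_+_ (v x * c)) (Σ-*ʳ v c xs)) (sym (ℤ.*-distribʳ-+ c (v x) _))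

length-concatMap : (f : I → List J) (k : ℕ) → (∀ x → length (f x) ≡ k) →
  ∀ xs → length (concatMap f xs) ≡ length xs ℕ.* k
length-concatMap f k e []       = refl
length-concatMap f k e (x ∷ xs) =
  trans (length-++ (f x)) (cong₂ ℕ._+_ (e x) (length-concatMap f k e xs))

concatMap-↭ : (f : I → List J) {xs ys : List I} → xs ↭ ys → concatMap f xs ↭ concatMap f ys
concatMap-↭ f Perm.refl        = ↭-refl
concatMap-↭ f (prep x p)  = ++⁺ˡ (f x) (concatMap-↭ f p)
concatMap-↭ f {ys = _ ∷ _ ∷ zs} (swap x y p) =
  ↭-trans (++⁺ˡ (f x) (++⁺ˡ (f y) (concatMap-↭ f p)))
        (↭-Solver.solve 3 (λ a b c → a ⊕ b ⊕ c ⊜ b ⊕ a ⊕ c) ↭-refl (f x) (f y) (concatMap f zs))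
  where open ↭-Solver
concatMap-↭ f (Perm.trans p q) = ↭-trans (concatMap-↭ f p) (concatMap-↭ f q)

splitAt-≤ : (k : ℕ) (xs : List I) → k ≤ length xs → ∃₂ λ ys zs → ys ++ zs ≡ xs × length ys ≡ k
splitAt-≤ zero    xs       _       = [] , xs , refl , refl
splitAt-≤ (suc k) (x ∷ xs) (s≤s h) with splitAt-≤ k xs h
... | ys , zs , refl , e = x ∷ ys , zs , refl , cong suc e

split-off : {P : I → Set} {xs : List I} → Any P xs →
  ∃₂ λ y ys → P y × y ∷ ys ↭ xs
split-off (here {x} {xs} px) = x , xs , px , ↭-refl
split-off (there {x} w) with split-off w
... | y , ys , py , σ = y , x ∷ ys , py , ↭-trans (swap y x ↭-refl) (prep x σ)

-- Congruence of integers

-- A record rather than an abbreviation: `x` and `y` can then be inferred from a congruence, whereas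
-- the difference `x - y` does not determine them.
record _≈_[_] (x y : ℤ) (p : ℕ) : Set where
  constructor congruent
  field ∣-diff : + p ∣ x - y

open _≈_[_]

∣-resp : ∀ {k x y} → x ≡ y → k ∣ x → k ∣ y
∣-resp refl d = d

module _ {p : ℕ} where

  ≈-refl : ∀ {x} → x ≈ x [ p ]
  ≈-refl {x} = congruent (divides 0ℤ (ℤ.+-inverseʳ x))

  ≈-reflexive : ∀ {x y} → x ≡ y → x ≈ y [ p ]
  ≈-reflexive refl = ≈-refl

  ≈-resp-diff : ∀ {x y z w} → x - y ≡ z - w → x ≈ y [ p ] → z ≈ w [ p ]
  ≈-resp-diff e (congruent d) = congruent (∣-resp e d)

  ≈-sym : ∀ {x y} → x ≈ y [ p ] → y ≈ x [ p ]
  ≈-sym {x} {y} (congruent d) = congruent (∣-resp (lem x y) (∣m⇒∣-m d))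
    where
    lem : ∀ x y → - (x - y) ≡ y - x
    lem = solve-∀

  ≈-trans : ∀ {x y z} → x ≈ y [ p ] → y ≈ z [ p ] → x ≈ z [ p ]
  ≈-trans {x} {y} {z} (congruent d) (congruent e) = congruent (∣-resp (lem x y z) (∣m∣n⇒∣m+n d e))
    where
    lem : ∀ x y z → (x - y) + (y - z) ≡ x - z
    lem = solve-∀

  +-cong-≈ : ∀ {x y z w} → x ≈ y [ p ] → z ≈ w [ p ] → x + z ≈ y + w [ p ]
  +-cong-≈ {x} {y} {z} {w} (congruent d) (congruent e) = congruent (∣-resp (lem x y z w) (∣m∣n⇒∣m+n d e))
    where
    lem : ∀ x y z w → (x - y) + (z - w) ≡ (x + z) - (y + w)
    lem = solve-∀

  ∣-resp-≈ : ∀ {x y} → x ≈ y [ p ] → + p ∣ y → + p ∣ x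
  ∣-resp-≈ {x} {y} (congruent d) e = ∣-resp (lem x y) (∣m∣n⇒∣m+n d e)
    where
    lem : ∀ x y → (x - y) + y ≡ x
    lem = solve-∀

  _≈?_ : ∀ x y → Dec (x ≈ y [ p ])
  x ≈? y = map′ congruent ∣-diff (+ p ∣? (x - y))

  Σ-const : (v : I → ℤ) (c : ℤ) {xs : List I} → All (λ x → v x ≈ c [ p ]) xs →
            Σ[ v ] xs ≈ + length xs * c [ p ]
  Σ-const v c []                   = ≈-reflexive (sym (ℤ.*-zeroˡ c))
  Σ-const v c {_ ∷ xs} (e ∷ es) = ≈-trans (+-cong-≈ e (Σ-const v c es)) (≈-reflexive (lem c (+ length xs)))
    where
    lem : ∀ c l → c + l * c ≡ (1ℤ + l) * c
    lem = solve-∀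

module _ {p : ℕ} .{{_ : ℕ.NonZero p}} where

  residue : ℤ → Fin p
  residue z = fromℕ< (n%ℕd<d z p)

  residue-≈ : ∀ {x y} → residue x ≡ residue y → x ≈ y [ p ]
  residue-≈ {x} {y} e = congruent (divides (x /ℕ p - y /ℕ p) (begin
      x - y
    ≡⟨ cong₂ _-_ (a≡a%ℕn+[a/ℕn]*n x p) (a≡a%ℕn+[a/ℕn]*n y p) ⟩
      (+ (x %ℕ p) + (x /ℕ p) * + p) - (+ (y %ℕ p) + (y /ℕ p) * + p)
    ≡⟨ cong (λ r → (+ r + (x /ℕ p) * + p) - (+ (y %ℕ p) + (y /ℕ p) * + p)) r≡ ⟩
      (+ (y %ℕ p) + (x /ℕ p) * + p) - (+ (y %ℕ p) + (y /ℕ p) * + p)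
    ≡⟨ lem (+ (y %ℕ p)) (x /ℕ p) (y /ℕ p) (+ p) ⟩
      (x /ℕ p - y /ℕ p) * + p ∎))
    where
    open ≡-Reasoning
    r≡ : x %ℕ p ≡ y %ℕ p
    r≡ = trans (sym (Fin.toℕ-fromℕ< (n%ℕd<d x p))) (trans (cong toℕ e) (Fin.toℕ-fromℕ< (n%ℕd<d y p)))
    lem : ∀ r a b p → (r + a * p) - (r + b * p) ≡ (a - b) * p
    lem = solve-∀

-- Sums of free choices modulo a prime

AllPairs-lookup : {R : I → I → Set} {xs : List I} → AllPairs R xs →
  ∀ {i j} → i Fin.< j → R (lookup xs i) (lookup xs j)
AllPairs-lookup (r ∷ rs) {Fin.zero}  {Fin.suc j} _       = All.lookup r (∈-lookup j)
AllPairs-lookup (r ∷ rs) {Fin.suc i} {Fin.suc j} (s≤s h) = AllPairs-lookup rs h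

∤-small : ∀ {p} k → 0 < k → k < p → ¬ + p ∣ + k
∤-small (suc k) _ k<p d = ℕ.<⇒≱ k<p (ℕ.∣⇒≤ (∣⇒∣ᵤ d))

slotValue : (f g : I → ℤ) → I × Bool → ℤ
slotValue f g (s , b) = if b then f s else g s

module _ {p : ℕ} (pp : Prime p) where

  private instance
    _ = prime⇒nonZero pp

  euclid : ∀ x y → + p ∣ x * y → + p ∣ x ⊎ + p ∣ y
  euclid x y d with euclidsLemma ℤ.∣ x ∣ ℤ.∣ y ∣ pp (subst (p ℕ.∣_) (ℤ.abs-* x y) (∣⇒∣ᵤ d))
  ... | inj₁ e = inj₁ (∣ᵤ⇒∣ e)
  ... | inj₂ e = inj₂ (∣ᵤ⇒∣ e)

  halve : ¬ + p ∣ + 2 → ∀ k → + p ∣ + 2 * k → + p ∣ k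
  halve p∤2 k d = [ ⊥-elim ∘ p∤2 , (λ e → e) ]′ (euclid (+ 2) k d)

  -- Modulo p, all points t₀ + j d lie in `T`. If `T` were shorter than p, two of them with 0 ≤ i <
  -- j < p would share a position, and p would divide (j - i) d.
  shift-closed⇒full : (d : ℤ) → ¬ + p ∣ d → (T : List ℤ) → 0 < length T →
    All (λ t → Any (λ u → t + d ≈ u [ p ]) T) T → p ≤ length T
  shift-closed⇒full d p∤d T@(t₀ ∷ _) _ closed = ℕ.≮⇒≥ λ T<p → collide (Fin.pigeonhole T<p (λ j → Any.index (walk (toℕ j))))
    where
    walk : ∀ j → Any (λ u → t₀ + + j * d ≈ u [ p ]) T
    walk zero    = here (≈-reflexive (lem t₀ d))
      where
      lem : ∀ t d → t + 0ℤ * d ≡ t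
      lem = solve-∀
    walk (suc j) with All.lookupAny closed (walk j)
    ... | w , e = Any.map (≈-trans (≈-trans (≈-reflexive (lem t₀ d (+ j))) (+-cong-≈ e (≈-refl {x = d})))) w
      where
      lem : ∀ t d j → t + (1ℤ + j) * d ≡ (t + j * d) + d
      lem = solve-∀
    lem : ∀ t d i j → (t + j * d) - (t + i * d) ≡ (j - i) * d
    lem = solve-∀
    collide : ¬ ∃₂ λ (i j : Fin p) → i Fin.< j × Any.index (walk (toℕ i)) ≡ Any.index (walk (toℕ j))
    collide (i , j , i<j , e) =
      [ ∤-small (toℕ j ℕ.∸ toℕ i) (ℕ.m<n⇒0<n∸m i<j) (ℕ.≤-<-trans (ℕ.m∸n≤m (toℕ j) (toℕ i)) (Fin.toℕ<n j))
      , p∤d ]′ (euclid _ d (∣-resp eq (∣-diff far)))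
      where
      far : (t₀ + + toℕ j * d) ≈ (t₀ + + toℕ i * d) [ p ]
      far = ≈-trans (Any.lookup-index (walk (toℕ j)))
              (≈-trans (≈-reflexive (cong (lookup T) (sym e))) (≈-sym (Any.lookup-index (walk (toℕ i)))))
      eq : (t₀ + + toℕ j * d) - (t₀ + + toℕ i * d) ≡ + (toℕ j ℕ.∸ toℕ i) * d
      eq = trans (lem t₀ d (+ toℕ i) (+ toℕ j))
             (cong (_* d) (trans (ℤ.m-n≡m⊖n (toℕ j) (toℕ i)) (ℤ.⊖-≥ (ℕ.<⇒≤ i<j))))

  -- The pigeonhole principle is applied to the residues of `z` and of all entries of `T`. Entries
  -- of `T` cannot collide with each other, so the collision involves `z`.
  distinct-full⇒hit : (T : List ℤ) → AllPairs (λ x y → ¬ x ≈ y [ p ]) T → p ≤ length T →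
    ∀ z → Any (_≈ z [ p ]) T
  distinct-full⇒hit T dist h z with Fin.pigeonhole (s≤s h) (λ { Fin.zero → residue {p} z ; (Fin.suc i) → residue (lookup T i) })
  ... | Fin.zero  , Fin.suc j , _       , e = Any.map (λ { refl → residue-≈ (sym e) }) (∈-lookup j)
  ... | Fin.suc i , Fin.suc j , s≤s i<j , e = ⊥-elim (AllPairs-lookup dist i<j (residue-≈ e))

  -- Going backwards through the slots, the set T of targets becomes
  -- (T - f s) ∪ (T - g s), which is larger unless T is everything.
  choices-hit : (f g : I → ℤ) (ss : List I) → All (λ s → ¬ f s ≈ g s [ p ]) ss →
    (T : List ℤ) → 0 < length T → AllPairs (λ x y → ¬ x ≈ y [ p ]) T →
    p ≤ length T ℕ.+ length ss →
    ∃ λ cs → map proj₁ cs ≡ ss × Any (λ t → t ≈ Σ[ slotValue f g ] cs [ p ]) T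
  choices-hit f g [] [] T _ dist h =
    [] , refl , distinct-full⇒hit T dist (subst (p ≤_) (ℕ.+-identityʳ _) h) 0ℤ
  choices-hit f g (s ∷ ss) (f≉g ∷ slots) T@(_ ∷ _) _ dist h = body
    where
    a = f s
    b = g s
    T′ = map (_- a) T

    move : ∀ t u x → (t - x) - u ≡ t - (x + u)
    move = solve-∀

    shift-cancel : ∀ x y a → (x - a) - (y - a) ≡ x - y
    shift-cancel = solve-∀

    T′-distinct : AllPairs (λ x y → ¬ x ≈ y [ p ]) T′
    T′-distinct = AllPairs.map⁺ (AllPairs.map (λ {x} {y} n e → n (≈-resp-diff (shift-cancel x y a) e)) dist)

    finish-a : ∀ cs → Any (λ t → t ≈ Σ[ slotValue f g ] cs [ p ]) T′ →
               Any (λ t → t ≈ a + Σ[ slotValue f g ] cs [ p ]) T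
    finish-a _ hit = Any.map (λ {t} → ≈-resp-diff (move t _ a)) (Any.map⁻ hit)

    Goal : Set
    Goal = ∃ λ cs → map proj₁ cs ≡ s ∷ ss × Any (λ t → t ≈ Σ[ slotValue f g ] cs [ p ]) T

    Reached : ℤ → Set
    Reached t = Any (λ u → t - b ≈ u [ p ]) T′

    reached? : ∀ t → Dec (Reached t)
    reached? t = Any.any? (λ u → (t - b) ≈? u) T′

    Tail : List ℤ → Set
    Tail U = ∃ λ cs → map proj₁ cs ≡ ss × Any (λ t → t ≈ Σ[ slotValue f g ] cs [ p ]) U

    -- The second choice adds no target. Then T - a is closed under adding a - b modulo p, hence
    -- already has at least p elements.
    from-closed : All Reached T → Goal
    from-closed closed = extend (choices-hit f g ss slots T′ (s≤s z≤n) T′-distinct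
                              (ℕ.≤-trans (shift-closed⇒full (a - b) (f≉g ∘ congruent) T′ (s≤s z≤n) closed′) (ℕ.m≤m+n _ _)))
      where
      back : ∀ t a b → (t - a) + (a - b) ≡ t - b
      back = solve-∀
      closed′ : All (λ t → Any (λ u → t + (a - b) ≈ u [ p ]) T′) T′
      closed′ = All.map⁺ (All.map (λ {t} → Any.map (≈-trans (≈-reflexive (back t a b)))) closed)
      extend : Tail T′ → Goal
      extend (cs , refl , hit) = (s , true) ∷ cs , refl , finish-a cs hit

    -- One new target t - b pays for the slot that is used up: the sum of the two lengths stays the
    -- same.
    from-new : ∀ {t} → t ∈ T → ¬ Reached t → Goal
    from-new {t} t∈T new = extend (choices-hit f g ss slots ((t - b) ∷ T′) (s≤s z≤n)
                  (All.¬Any⇒All¬ T′ new ∷ T′-distinct)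
                  (subst (p ≤_) (trans (ℕ.+-suc (length T) _) (cong (λ l → suc (l ℕ.+ length ss)) (sym (length-map (_- a) T)))) h))
      where
      extend : Tail ((t - b) ∷ T′) → Goal
      extend (cs , refl , here e)    = (s , false) ∷ cs , refl , lose t∈T (≈-resp-diff (move t _ b) e)
      extend (cs , refl , there hit) = (s , true) ∷ cs , refl , finish-a cs hit

    body : Goal
    body with All.all? reached? T
    ... | yes closed = from-closed closed
    ... | no ¬closed with find (All.¬All⇒Any¬ reached? T ¬closed)
    ...   | t , t∈T , new = from-new t∈T new

-- Growing a family of disjoint incongruent pairs: when the unpaired elements
-- are all congruent to some c, a pair avoiding c can be split and rematched
-- with two of them; if there is no such pair, c has a representative in each.
module _ {I : Set} (p : ℕ) (v : I → ℤ) where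

  Incongruent : I × I → Set
  Incongruent (x , y) = ¬ v x ≈ v y [ p ]

  pairElements : I × I → List I
  pairElements (x , y) = x ∷ y ∷ []

  flattenPairs : List (I × I) → List I
  flattenPairs = concatMap pairElements

  VanishingSubset : ℕ → List I → Set
  VanishingSubset k xs = ∃₂ λ ys zs → ys ++ zs ↭ xs × length ys ≡ k × + p ∣ Σ[ v ] ys

  IncongruentPairs : ℕ → List I → Set
  IncongruentPairs k xs =
    ∃₂ λ prs rest → flattenPairs prs ++ rest ↭ xs × length prs ≡ k × All Incongruent prs

  private
    Misses : I → I × I → Set
    Misses c (x , y) = ¬ v x ≈ v c [ p ] × ¬ v y ≈ v c [ p ]

    misses? : ∀ c pr → Dec (Misses c pr)
    misses? c (x , y) = ¬? (v x ≈? v c) ×-dec ¬? (v y ≈? v c)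

    representatives : ∀ c prs → All (λ pr → ¬ Misses c pr) prs →
      ∃₂ λ xs ys → xs ++ ys ↭ flattenPairs prs × length xs ≡ length prs × All (λ x → v x ≈ v c [ p ]) xs
    representatives c [] [] = [] , [] , ↭-refl , refl , []
    representatives c ((x , y) ∷ prs) (na ∷ nas) with representatives c prs nas | v x ≈? v c | v y ≈? v c
    ... | xs , ys , σ , l , cs | yes x≈c | _ =
      x ∷ xs , y ∷ ys , prep x (↭-trans (shift y xs ys) (prep y σ)) , cong suc l , x≈c ∷ cs
    ... | xs , ys , σ , l , cs | no _ | yes y≈c =
      y ∷ xs , x ∷ ys , ↭-trans (prep y (↭-trans (shift x xs ys) (prep x σ))) (swap y x ↭-refl) , cong suc l , y≈c ∷ cs
    ... | _ | no x≉c | no y≉c = ⊥-elim (na (x≉c , y≉c))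

  vanishing-constant : ∀ c {xs} → All (λ x → v x ≈ c [ p ]) xs → length xs ≡ p → + p ∣ Σ[ v ] xs
  vanishing-constant c {xs} all l =
    ∣-resp-≈ (Σ-const v c all) (subst (λ k → + p ∣ + k * c) (sym l) (∣m⇒∣m*n c ∣-refl))

  private
    length-flatten : ∀ prs → length (flattenPairs prs) ≡ length prs ℕ.* 2
    length-flatten = length-concatMap pairElements 2 (λ _ → refl)

    many-congruent : ∀ c prs rest {xs} → flattenPairs prs ++ rest ↭ xs →
      All (λ pr → ¬ Misses c pr) prs → All (λ x → v x ≈ v c [ p ]) rest →
      p ≤ length prs ℕ.+ length rest → VanishingSubset p xs
    many-congruent c prs rest {xs} σ nas cs h with representatives c prs nas
    ... | ys , zs , τ , l , ds with splitAt-≤ p (ys ++ rest)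
              (subst (p ≤_) (sym (trans (length-++ ys) (cong (ℕ._+ length rest) l))) h)
    ...   | as , bs , eq , la = as , bs ++ zs , perm , la ,
              vanishing-constant (v c) (All.++⁻ˡ as (subst (All _) (sym eq) (All.++⁺ ds cs))) la
      where
      open PermutationReasoning
      perm : as ++ (bs ++ zs) ↭ xs
      perm = begin
        as ++ (bs ++ zs)        ≡⟨ sym (++-assoc as bs zs) ⟩
        (as ++ bs) ++ zs        ≡⟨ cong (_++ zs) eq ⟩
        (ys ++ rest) ++ zs      ↭⟨ ↭-Solver.solve 3 (λ a b c → (a ⊕ b) ⊕ c ⊜ (a ⊕ c) ⊕ b) ↭-refl ys rest zs ⟩
        (ys ++ zs) ++ rest      ↭⟨ ++⁺ʳ rest τ ⟩
        flattenPairs prs ++ rest ↭⟨ σ ⟩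
        xs                      ∎
        where open ↭-Solver

  -- Once l pairs are built and one more is wanted, at least p - l elements are unpaired. This
  -- suffices for p elements congruent to `c` if each pair contributes one, and it is at least two
  -- because l + 1 < p; rematching a pair consumes two.
  congruent-or-pairs : ∀ k xs → k < p → p ℕ.+ k ≤ suc (length xs) →
    VanishingSubset p xs ⊎ IncongruentPairs k xs
  congruent-or-pairs zero    xs _   _ = inj₂ ([] , xs , ↭-refl , refl , [])
  congruent-or-pairs (suc k) xs k<p h
    with congruent-or-pairs k xs (ℕ.<-trans (ℕ.n<1+n k) k<p) (ℕ.≤-trans (ℕ.+-monoʳ-≤ p (ℕ.n≤1+n k)) h)
  ... | inj₁ vanishing = inj₁ vanishing
  ... | inj₂ (prs , rest , σ , refl , inc) = grow rest σ enough
    where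
    length-xs : ∀ r → flattenPairs prs ++ r ↭ xs → length xs ≡ length prs ℕ.* 2 ℕ.+ length r
    length-xs r τ = trans (sym (↭-length τ)) (trans (length-++ (flattenPairs prs)) (cong (ℕ._+ length r) (length-flatten prs)))
    enough : p ≤ length prs ℕ.+ length rest
    enough = ℕ.+-cancelʳ-≤ (suc (length prs)) p _ (ℕ.≤-trans h (ℕ.≤-reflexive
      (trans (cong suc (length-xs rest σ)) (count (length prs) (length rest)))))
      where
      count : ∀ l r → suc (l ℕ.* 2 ℕ.+ r) ≡ (l ℕ.+ r) ℕ.+ suc l
      count = ℕ-solve-∀

    grow : ∀ rest → flattenPairs prs ++ rest ↭ xs → p ≤ length prs ℕ.+ length rest →
      VanishingSubset p xs ⊎ IncongruentPairs (suc (length prs)) xs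
    grow []               _ h = ⊥-elim (ℕ.<⇒≱ (ℕ.<-trans (ℕ.n<1+n _) k<p) (subst (p ≤_) (ℕ.+-identityʳ _) h))
    grow (c ∷ [])         _ h = ⊥-elim (ℕ.<⇒≱ k<p (subst (p ≤_) (ℕ.+-comm _ 1) h))
    grow (c ∷ rest@(z ∷ rest′)) σ h with Any.any? (λ y → ¬? (v c ≈? v y)) rest
    ... | yes w with split-off w
    ...   | y , r , c≉y , τ = inj₂ ((c , y) ∷ prs , r , perm , refl , c≉y ∷ inc)
      where
      perm : c ∷ y ∷ flattenPairs prs ++ r ↭ xs
      perm = ↭-trans (↭-trans (↭-sym (shifts (flattenPairs prs) (c ∷ y ∷ []))) (++⁺ˡ (flattenPairs prs) (prep c τ))) σ
    grow (c ∷ rest@(z ∷ rest′)) σ h | no none with Any.any? (misses? c) prs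
    ... | no nav = inj₁ (many-congruent c prs (c ∷ rest) σ (All.¬Any⇒All¬ prs nav)
                     (≈-refl ∷ All.map (λ {y} n → ≈-sym (decidable-stable (v c ≈? v y) n)) (All.¬Any⇒All¬ rest none)) h)
    ... | yes w with split-off w
    ...   | (x , y) , prs′ , (x≉c , y≉c) , τ =
      inj₂ ((x , c) ∷ (y , z) ∷ prs′ , rest′ , perm , cong suc (↭-length τ) , x≉c ∷ y≉z ∷ All.tail (All-resp-↭ (↭-sym τ) inc))
      where
      z≈c : v z ≈ v c [ p ]
      z≈c = ≈-sym (decidable-stable (v c ≈? v z) (All.head (All.¬Any⇒All¬ rest none)))
      y≉z : ¬ v y ≈ v z [ p ]
      y≉z e = y≉c (≈-trans e z≈c)
      open PermutationReasoning
      perm : x ∷ c ∷ y ∷ z ∷ flattenPairs prs′ ++ rest′ ↭ xs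
      perm = begin
        x ∷ c ∷ y ∷ z ∷ flattenPairs prs′ ++ rest′
          ↭⟨ ↭-Solver.solve 6 (λ x c y z f r → x ⊕ c ⊕ y ⊕ z ⊕ f ⊕ r ⊜ (x ⊕ y ⊕ f) ⊕ c ⊕ z ⊕ r) ↭-refl
               (x ∷ []) (c ∷ []) (y ∷ []) (z ∷ []) (flattenPairs prs′) rest′ ⟩
        flattenPairs ((x , y) ∷ prs′) ++ c ∷ z ∷ rest′
          ↭⟨ ++⁺ʳ (c ∷ z ∷ rest′) (concatMap-↭ pairElements τ) ⟩
        flattenPairs prs ++ c ∷ z ∷ rest′
          ↭⟨ σ ⟩
        xs ∎
        where open ↭-Solver

  -- The sums of one element from each of k incongruent pairs take at least
  -- k + 1 values mod p.
  subset-sums : (pp : Prime p) → ∀ k xs → k < p → p ℕ.+ k ≤ suc (length xs) →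
    VanishingSubset p xs ⊎
    ((T : List ℤ) → 0 < length T → AllPairs (λ x y → ¬ x ≈ y [ p ]) T → p ≤ length T ℕ.+ k →
      ∃₂ λ ys zs → ys ++ zs ↭ xs × length ys ≡ k × Any (λ t → t ≈ Σ[ v ] ys [ p ]) T)
  subset-sums pp k xs k<p h with congruent-or-pairs k xs k<p h
  ... | inj₁ vanishing = inj₁ vanishing
  ... | inj₂ (prs , rest , σ , refl , inc) = inj₂ λ T T≢[] dist h′ →
          select T (choices-hit pp (v ∘ proj₁) (v ∘ proj₂) prs inc T T≢[] dist h′)
    where
    pick : (I × I) × Bool → I
    pick ((x , y) , b) = if b then x else y
    drop : (I × I) × Bool → I
    drop ((x , y) , b) = if b then y else x

    partition : ∀ cs → map pick cs ++ map drop cs ↭ flattenPairs (map proj₁ cs)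
    partition []                       = ↭-refl
    partition (((x , y) , true) ∷ cs)  = prep x (↭-trans (shift y (map pick cs) (map drop cs)) (prep y (partition cs)))
    partition (((x , y) , false) ∷ cs) =
      ↭-trans (prep y (↭-trans (shift x (map pick cs) (map drop cs)) (prep x (partition cs)))) (swap y x ↭-refl)

    value-pick : ∀ c → slotValue (v ∘ proj₁) (v ∘ proj₂) c ≡ v (pick c)
    value-pick (_ , true)  = refl
    value-pick (_ , false) = refl

    select : ∀ T → _ → ∃₂ λ ys zs → ys ++ zs ↭ xs × length ys ≡ length prs × Any (λ t → t ≈ Σ[ v ] ys [ p ]) T
    select T (cs , e , hit) = map pick cs , map drop cs ++ rest
      , ↭-trans (↭-reflexive (sym (++-assoc (map pick cs) (map drop cs) rest)))
          (↭-trans (++⁺ʳ rest (↭-trans (partition cs) (↭-reflexive (cong flattenPairs e)))) σ)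
      , trans (length-map pick cs) (trans (sym (length-map proj₁ cs)) (cong length e))
      , Any.map (λ {t} h → ≈-trans h (≈-reflexive (trans (Σ-cong value-pick cs) (sym (Σ-map v pick cs))))) hit

-- The Erdős-Ginzburg-Ziv theorem and its weighted version

-- The quotient is stored because it is the value of the group when the group itself becomes an
-- item, one prime factor further on.
record Group {I : Set} (v : I → ℤ) (m : ℕ) : Set where
  constructor group
  field
    members : List I
    quotient : ℤ
    card     : length members ≡ m
    total    : Σ[ v ] members ≡ quotient * + m

open Group

gather : {v : I → ℤ} {m : ℕ} → List (Group v m) → List I
gather = concatMap members

module _ {v : I → ℤ} {m : ℕ} where

  length-gather : (gs : List (Group v m)) → length (gather gs) ≡ length gs ℕ.* m
  length-gather = length-concatMap members m card

  Σ-gather : (gs : List (Group v m)) → Σ[ v ] gather gs ≡ (Σ[ quotient ] gs) * + m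
  Σ-gather gs = trans (Σ-concatMap v members gs) (trans (Σ-cong total gs) (Σ-*ʳ quotient (+ m) gs))

  gather-split : ∀ (ys zs : List (Group v m)) {gs rest xs} → ys ++ zs ↭ gs → gather gs ++ rest ↭ xs →
    gather ys ++ (gather zs ++ rest) ↭ xs
  gather-split ys zs {rest = rest} σ τ =
    ↭-trans (↭-reflexive (trans (sym (++-assoc (gather ys) _ _)) (cong (_++ rest) (sym (concatMap-++ members ys zs)))))
      (↭-trans (++⁺ʳ rest (concatMap-↭ members σ)) τ)

-- The bound is length at least 2m - 1, written without subtraction. Item types are quantified over
-- because in `EGZ-*` the items are themselves groups.
EGZ : ℕ → Set₁
EGZ m = ∀ {I : Set} (v : I → ℤ) (xs : List I) → m ℕ.+ m ≤ suc (length xs) → VanishingSubset m v m xs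

record Extraction {I : Set} (v : I → ℤ) (m t : ℕ) (xs : List I) : Set where
  constructor extraction
  field
    groups : List (Group v m)
    rest   : List I
    perm   : gather groups ++ rest ↭ xs
    count  : length groups ≡ t

  length-rest : t ℕ.* m ℕ.+ length rest ≡ length xs
  length-rest = trans (cong (ℕ._+ length rest) (trans (cong (ℕ._* m) (sym count)) (sym (length-gather groups))))
    (trans (sym (length-++ (gather groups))) (↭-length perm))

-- Greedy removal: before each group is taken, at least 2m - 1 entries remain.
extract : ∀ {m} → EGZ m → ∀ t {I : Set} (v : I → ℤ) (xs : List I) → suc t ℕ.* m ≤ suc (length xs) →
  Extraction v m t xs
extract egz zero    v xs h = extraction [] xs ↭-refl refl
extract {m} egz (suc t) v xs h with egz v xs (ℕ.≤-trans (ℕ.+-monoʳ-≤ m (ℕ.m≤m+n m (t ℕ.* m))) h)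
... | ys , zs , σ , l , divides q eq with extract egz t v zs
        (ℕ.+-cancelˡ-≤ m _ _ (ℕ.≤-trans h (ℕ.≤-reflexive (trans (cong suc (trans (sym (↭-length σ)) (trans (length-++ ys) (cong (ℕ._+ length zs) l)))) (sym (ℕ.+-suc m _))))))
...   | extraction gs rest τ c =
  extraction (group ys q l eq ∷ gs) rest
    (↭-trans (↭-reflexive (++-assoc ys (gather gs) rest)) (↭-trans (++⁺ˡ ys τ) σ)) (cong suc c)

∣-quotient : ∀ {v : I → ℤ} {m k} (gs : List (Group v m)) → + k ∣ Σ[ quotient ] gs → + (k ℕ.* m) ∣ Σ[ v ] gather gs
∣-quotient {m = m} {k} gs (divides q e) = divides q (trans (Σ-gather gs) (trans (cong (_* + m) e)
  (trans (ℤ.*-assoc q (+ k) (+ m)) (cong (q *_) (sym (ℤ.pos-* k m))))))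

-- The classical reduction to prime factors: `b + suc b` is 2(b + 1) - 1, just enough groups of size
-- `a` to apply the second hypothesis to their quotients.
EGZ-* : ∀ {a b} → EGZ a → EGZ (suc b) → EGZ (suc b ℕ.* a)
EGZ-* {a} {b} egz-a egz-b v xs h with extract egz-a (b ℕ.+ suc b) v xs
    (subst (_≤ suc (length xs)) (sym (ℕ.*-distribʳ-+ a (suc b) (suc b))) h)
... | extraction gs rest σ c with egz-b quotient gs (s≤s (ℕ.≤-reflexive (sym c)))
...   | ys , zs , τ , l , d =
  gather ys , gather zs ++ rest , gather-split ys zs τ σ , trans (length-gather ys) (cong (ℕ._* a) l) , ∣-quotient ys d

1∣_ : ∀ x → + 1 ∣ x
1∣ x = divides x (sym (ℤ.*-identityʳ x))

EGZ-1 : EGZ 1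
EGZ-1 v (x ∷ xs) h = x ∷ [] , xs , ↭-refl , refl , 1∣ _
EGZ-1 v []       (s≤s ())

-- One entry x is set aside. Unless p of the remaining entries already vanish, these contain p - 1
-- disjoint incongruent pairs, whose sums hit every residue and in particular - v x.
EGZ-prime : ∀ {p} → Prime p → EGZ p
EGZ-prime {zero}  pp v xs h = ⊥-elim (¬prime[0] pp)
EGZ-prime {suc k} pp v [] (s≤s h) = ⊥-elim (ℕ.<⇒≱ (s≤s z≤n) (subst (_≤ 0) (ℕ.+-suc k k) h))
EGZ-prime {suc k} pp v (x ∷ xs) (s≤s h)
  with subset-sums (suc k) v pp k xs (ℕ.n<1+n k) (subst (_≤ suc (length xs)) (ℕ.+-suc k k) h)
... | inj₁ (ys , zs , σ , l , d) = ys , x ∷ zs , ↭-trans (shift x ys zs) (prep x σ) , l , d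
... | inj₂ sums with sums (- v x ∷ []) (s≤s z≤n) ([] ∷ []) ℕ.≤-refl
...   | ys , zs , σ , l , here (congruent d) = x ∷ ys , zs , prep x σ , cong suc l , ∣-resp (lem (v x) _) (∣m⇒∣-m d)
  where
  lem : ∀ a s → - (- a - s) ≡ a + s
  lem = solve-∀

-- q is the value of an indivisible item that counts as two elements.
data Weighted (m : ℕ) {I : Set} (v : I → ℤ) (q : ℤ) (xs : List I) : Set where
  without  : VanishingSubset m v m xs → Weighted m v q xs
  with-q   : ∀ ys zs → ys ++ zs ↭ xs → 2 ℕ.+ length ys ≡ m → + m ∣ q + Σ[ v ] ys → Weighted m v q xs
  everything : + m ∣ q + Σ[ v ] xs → Weighted m v q xs

WeightedEGZ : ℕ → Set₁
WeightedEGZ m = ∀ {I : Set} (v : I → ℤ) q (xs : List I) → 2 ℕ.+ length xs ≡ m ℕ.+ m → Weighted m v q xs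

WeightedEGZ-1 : WeightedEGZ 1
WeightedEGZ-1 v q xs h = everything (1∣ _)

-- A p-subset sum is the total minus a (p - 2)-subset sum, and the latter sums
-- take at least p - 1 values, so they meet {- q , total} unless - q is the total.
WeightedEGZ-prime : ∀ {p} → Prime p → WeightedEGZ p
WeightedEGZ-prime {zero}  pp v q xs h = ⊥-elim (¬prime[0] pp)
WeightedEGZ-prime {suc zero}  pp v q xs h = ⊥-elim (¬prime[1] pp)
WeightedEGZ-prime {2+ k} pp v q xs h = cases (_≈?_ {p = 2+ k} (- q) (Σ[ v ] xs))
  where
  length-xs : length xs ≡ k ℕ.+ (2+ k)
  length-xs = ℕ.suc-injective (ℕ.suc-injective h)

  neg : ∀ a s → - (- a - s) ≡ a + s
  neg = solve-∀
  rest-sum : ∀ a b → (a + b) - a ≡ b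
  rest-sum = solve-∀

  cases : Dec (- q ≈ Σ[ v ] xs [ 2+ k ]) → Weighted (2+ k) v q xs
  cases (yes (congruent d)) = everything (∣-resp (neg q _) (∣m⇒∣-m d))
  cases (no ne) with subset-sums (2+ k) v pp k xs (ℕ.≤-trans (ℕ.n<1+n k) (ℕ.n≤1+n _))
                       (ℕ.≤-trans (ℕ.≤-reflexive (trans (ℕ.+-comm (2+ k) k) (sym length-xs))) (ℕ.n≤1+n _))
  ... | inj₁ vanishing = without vanishing
  ... | inj₂ sums with sums (- q ∷ Σ[ v ] xs ∷ []) (s≤s z≤n) ((ne ∷ []) ∷ [] ∷ []) ℕ.≤-refl
  ...   | ys , zs , σ , l , here (congruent d) = with-q ys zs σ (cong 2+ l) (∣-resp (neg q _) (∣m⇒∣-m d))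
  ...   | ys , zs , σ , l , there (here (congruent d)) =
    without (zs , ys , ↭-trans (++-comm zs ys) σ , length-zs , ∣-resp eq d)
    where
    length-zs : length zs ≡ 2+ k
    length-zs = ℕ.+-cancelˡ-≡ k _ _ (trans (cong (ℕ._+ length zs) (sym l))
                  (trans (sym (length-++ ys)) (trans (↭-length σ) length-xs)))
    eq : Σ[ v ] xs - Σ[ v ] ys ≡ Σ[ v ] zs
    eq = trans (cong (_- Σ[ v ] ys) (trans (sym (Σ-↭ v σ)) (Σ-++ v ys zs))) (rest-sum (Σ[ v ] ys) (Σ[ v ] zs))

nothings : List (Maybe I) → ℕ
nothings []             = 0
nothings (just _ ∷ xs)  = nothings xs
nothings (nothing ∷ xs) = suc (nothings xs)

length-catMaybes : (xs : List (Maybe I)) → length xs ≡ nothings xs ℕ.+ length (catMaybes xs)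
length-catMaybes []             = refl
length-catMaybes (just x ∷ xs)  = trans (cong suc (length-catMaybes xs)) (sym (ℕ.+-suc (nothings xs) _))
length-catMaybes (nothing ∷ xs) = cong suc (length-catMaybes xs)

module _ {I : Set} (v : I → ℤ) (q : ℤ) where

  marked : Maybe I → ℤ
  marked = maybe v q

  Σ-marked : ∀ xs → Σ[ marked ] xs ≡ + nothings xs * q + Σ[ v ] catMaybes xs
  Σ-marked []             = sym (trans (ℤ.+-identityʳ _) (ℤ.*-zeroˡ q))
  Σ-marked (just x ∷ xs)  = trans (cong (_+_ (v x)) (Σ-marked xs)) (lem (v x) (+ nothings xs * q) _)
    where
    lem : ∀ a b c → a + (b + c) ≡ b + (a + c)
    lem = solve-∀
  Σ-marked (nothing ∷ xs) = trans (cong (_+_ q) (Σ-marked xs)) (lem q (+ nothings xs) _)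
    where
    lem : ∀ q n s → q + (n * q + s) ≡ (1ℤ + n) * q + s
    lem = solve-∀

  -- EGZ with one additional item `nothing` of value q and weight one. It occurs only once, so the
  -- two outcomes say whether it was selected.
  EGZ-marked : ∀ {m} → EGZ m → ∀ xs → m ℕ.+ m ≤ 2 ℕ.+ length xs →
    VanishingSubset m v m xs ⊎
    ∃₂ λ ys zs → ys ++ zs ↭ xs × 1 ℕ.+ length ys ≡ m × + m ∣ q + Σ[ v ] ys
  EGZ-marked {m} egz xs h with egz marked (nothing ∷ map just xs)
                       (ℕ.≤-trans h (ℕ.≤-reflexive (cong 2+ (sym (length-map just xs)))))
  ... | ys , zs , σ , l , d = cases (nothings ys) refl
    where
    perm : catMaybes ys ++ catMaybes zs ↭ xs
    perm = ↭-trans (↭-reflexive (sym (catMaybes-++ ys zs)))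
             (↭-trans (catMaybes-↭ σ) (↭-reflexive (mapMaybe-just xs)))

    one-nothing : nothings ys ℕ.+ nothings zs ≡ 1
    one-nothing = ℕ.+-cancelʳ-≡ (length xs) _ _ (begin
      nothings ys ℕ.+ nothings zs ℕ.+ length xs
        ≡⟨ cong (nothings ys ℕ.+ nothings zs ℕ.+_) (trans (sym (↭-length perm)) (length-++ (catMaybes ys))) ⟩
      nothings ys ℕ.+ nothings zs ℕ.+ (length (catMaybes ys) ℕ.+ length (catMaybes zs))
        ≡⟨ interchange (nothings ys) (nothings zs) _ _ ⟩
      (nothings ys ℕ.+ length (catMaybes ys)) ℕ.+ (nothings zs ℕ.+ length (catMaybes zs))
        ≡⟨ sym (cong₂ ℕ._+_ (length-catMaybes ys) (length-catMaybes zs)) ⟩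
      length ys ℕ.+ length zs
        ≡⟨ trans (sym (length-++ ys)) (trans (↭-length σ) (cong suc (length-map just xs))) ⟩
      suc (length xs) ∎)
      where
      open ≡-Reasoning
      interchange : ∀ a b c d → a ℕ.+ b ℕ.+ (c ℕ.+ d) ≡ (a ℕ.+ c) ℕ.+ (b ℕ.+ d)
      interchange = ℕ-solve-∀

    length-ys : nothings ys ℕ.+ length (catMaybes ys) ≡ m
    length-ys = trans (sym (length-catMaybes ys)) l

    cases : ∀ n → nothings ys ≡ n → _
    cases 0 e = inj₁ (catMaybes ys , catMaybes zs , perm , subst (λ n → n ℕ.+ length (catMaybes ys) ≡ m) e length-ys
                     , ∣-resp (trans (Σ-marked ys) (trans (cong (λ n → + n * q + Σ[ v ] catMaybes ys) e) (lem q _))) d)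
      where
      lem : ∀ q s → + 0 * q + s ≡ s
      lem = solve-∀
    cases 1 e = inj₂ (catMaybes ys , catMaybes zs , perm , subst (λ n → n ℕ.+ length (catMaybes ys) ≡ m) e length-ys
                     , ∣-resp (trans (Σ-marked ys) (trans (cong (λ n → + n * q + Σ[ v ] catMaybes ys) e) (lem q _))) d)
      where
      lem : ∀ q s → + 1 * q + s ≡ q + s
      lem = solve-∀
    cases (2+ n) e = ⊥-elim (case trans (cong (ℕ._+ nothings zs) (sym e)) one-nothing of λ ())

-- Let A and B be the two factors. Extracting 2B - 2 groups of size A leaves 2A - 2 entries, exactly
-- the weighted situation for A. Its outcomes are a further group, making 2B - 1 for EGZ; a group
-- that contains q and acts as an item of weight one; or all that is left together with q, which is
-- again one item of weight two for B.
WeightedEGZ-* : ∀ {a b} → EGZ (suc a) → EGZ (suc b) → WeightedEGZ (suc a) → WeightedEGZ (suc b) →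
  WeightedEGZ (suc b ℕ.* suc a)
WeightedEGZ-* {a′} {b} egz-a egz-b wegz-a wegz-b v q xs h with extract egz-a (b ℕ.+ b) v xs enough
  where
  enough : suc (b ℕ.+ b) ℕ.* suc a′ ≤ suc (length xs)
  enough = ℕ.+-cancelˡ-≤ 1 _ _ (subst (1 ℕ.+ suc (b ℕ.+ b) ℕ.* suc a′ ≤_) (sym (trans h (lem a′ b)))
             (ℕ.+-monoˡ-≤ (suc (b ℕ.+ b) ℕ.* suc a′) (s≤s z≤n)))
    where
    lem : ∀ a b → suc b ℕ.* suc a ℕ.+ suc b ℕ.* suc a ≡ suc a ℕ.+ suc (b ℕ.+ b) ℕ.* suc a
    lem = ℕ-solve-∀
... | ex@(extraction gs rest σ c) = cases (wegz-a v q rest length-rest≡)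
  where
  a = suc a′
  m = suc b ℕ.* a

  length-rest≡ : 2 ℕ.+ length rest ≡ a ℕ.+ a
  length-rest≡ = ℕ.+-cancelˡ-≡ ((b ℕ.+ b) ℕ.* a) _ _ (trans (lem ((b ℕ.+ b) ℕ.* a) (length rest))
    (trans (cong 2+ (Extraction.length-rest ex)) (trans h (lem₂ a b))))
    where
    lem : ∀ x y → x ℕ.+ (2 ℕ.+ y) ≡ 2 ℕ.+ (x ℕ.+ y)
    lem = ℕ-solve-∀
    lem₂ : ∀ a b → suc b ℕ.* a ℕ.+ suc b ℕ.* a ≡ (b ℕ.+ b) ℕ.* a ℕ.+ (a ℕ.+ a)
    lem₂ = ℕ-solve-∀

  count-gs : 2 ℕ.+ length gs ≡ suc b ℕ.+ suc b
  count-gs = trans (cong 2+ c) (cong suc (sym (ℕ.+-suc b b)))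

  without-q : ∀ {gs rest} → gather gs ++ rest ↭ xs → VanishingSubset (suc b) quotient (suc b) gs → Weighted m v q xs
  without-q {rest = rest} σ (ys , zs , τ , l , d) =
    without (gather ys , gather zs ++ rest , gather-split ys zs τ σ , trans (length-gather ys) (cong (ℕ._* a) l) , ∣-quotient ys d)

  through-q : ∀ {gs} ys us zs q′ → gather gs ++ ys ++ zs ↭ xs → q + Σ[ v ] ys ≡ q′ * + a →
    ∀ {ws} → us ++ ws ↭ gs → 2 ℕ.+ (length us ℕ.* a ℕ.+ length ys) ≡ m → + suc b ∣ q′ + Σ[ quotient ] us → Weighted m v q xs
  through-q {gs} ys us zs q′ σ e {ws} τ l (divides r e′) =
    with-q (gather us ++ ys) (gather ws ++ zs) perm
      (trans (cong 2+ (trans (length-++ (gather us)) (cong (ℕ._+ length ys) (length-gather us)))) l)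
      (divides r sum≡)
    where
    open PermutationReasoning
    perm : (gather us ++ ys) ++ (gather ws ++ zs) ↭ xs
    perm = begin
      (gather us ++ ys) ++ (gather ws ++ zs)
        ↭⟨ ↭-Solver.solve 4 (λ u y w z → (u ⊕ y) ⊕ (w ⊕ z) ⊜ u ⊕ (w ⊕ (y ⊕ z))) ↭-refl (gather us) ys (gather ws) zs ⟩
      gather us ++ (gather ws ++ ys ++ zs)
        ↭⟨ gather-split us ws τ σ ⟩
      xs ∎
      where open ↭-Solver
    sum≡ : q + Σ[ v ] (gather us ++ ys) ≡ r * + m
    sum≡ = trans (cong (_+_ q) (trans (Σ-++ v (gather us) ys) (cong (_+ Σ[ v ] ys) (Σ-gather us))))
      (trans (lem q _ _) (trans (cong (_+ (Σ[ quotient ] us) * + a) e) (trans (sym (ℤ.*-distribʳ-+ (+ a) q′ _))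
      (trans (cong (_* + a) e′) (trans (ℤ.*-assoc r (+ suc b) (+ a)) (cong (r *_) (sym (ℤ.pos-* (suc b) a))))))))
      where
      lem : ∀ q g y → q + (g + y) ≡ (q + y) + g
      lem = solve-∀

  cases : Weighted a v q rest → Weighted m v q xs
  cases (without (ys , zs , τ , l , divides r e)) =
    without-q {group ys r l e ∷ gs} {zs} perm (egz-b quotient _ (ℕ.≤-reflexive (sym count-gs)))
    where
    open PermutationReasoning
    perm : (ys ++ gather gs) ++ zs ↭ xs
    perm = begin
      (ys ++ gather gs) ++ zs
        ↭⟨ ↭-Solver.solve 3 (λ y g z → (y ⊕ g) ⊕ z ⊜ g ⊕ (y ⊕ z)) ↭-refl ys (gather gs) zs ⟩
      gather gs ++ (ys ++ zs) ↭⟨ ++⁺ˡ (gather gs) τ ⟩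
      gather gs ++ rest       ↭⟨ σ ⟩
      xs ∎
      where open ↭-Solver
  cases (with-q ys zs τ l (divides r e)) with EGZ-marked quotient r egz-b gs (ℕ.≤-reflexive (sym count-gs))
  ... | inj₁ vanishing = without-q σ vanishing
  ... | inj₂ (us , ws , ρ , l′ , d) = through-q {gs} ys us zs r (↭-trans (++⁺ˡ (gather gs) τ) σ) e ρ len d
    where
    len : 2 ℕ.+ (length us ℕ.* a ℕ.+ length ys) ≡ m
    len = trans (lem (length us) a (length ys)) (trans (cong (λ k → length us ℕ.* a ℕ.+ k) l)
      (trans (lem₂ (length us) a) (cong (ℕ._* a) l′)))
      where
      lem : ∀ u a y → 2 ℕ.+ (u ℕ.* a ℕ.+ y) ≡ u ℕ.* a ℕ.+ (2 ℕ.+ y)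
      lem = ℕ-solve-∀
      lem₂ : ∀ u a → u ℕ.* a ℕ.+ a ≡ (1 ℕ.+ u) ℕ.* a
      lem₂ = ℕ-solve-∀
  cases (everything (divides r e)) with wegz-b quotient r gs count-gs
  ... | without vanishing = without-q σ vanishing
  ... | with-q us ws ρ l′ d =
      through-q {gs} rest us [] r (↭-trans (++⁺ˡ (gather gs) (↭-reflexive (++-identityʳ rest))) σ) e ρ len d
    where
    len : 2 ℕ.+ (length us ℕ.* a ℕ.+ length rest) ≡ m
    len = trans (lem (length us) a (length rest)) (trans (cong (λ k → length us ℕ.* a ℕ.+ k) length-rest≡)
      (trans (lem₂ (length us) a) (cong (ℕ._* a) l′)))
      where
      lem : ∀ u a y → 2 ℕ.+ (u ℕ.* a ℕ.+ y) ≡ u ℕ.* a ℕ.+ (2 ℕ.+ y)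
      lem = ℕ-solve-∀
      lem₂ : ∀ u a → u ℕ.* a ℕ.+ (a ℕ.+ a) ≡ (2 ℕ.+ u) ℕ.* a
      lem₂ = ℕ-solve-∀
  ... | everything (divides s e′) = everything (divides s (trans (cong (_+_ q) (trans (sym (Σ-↭ v σ)) (trans (Σ-++ v (gather gs) rest) (cong (_+ Σ[ v ] rest) (Σ-gather gs)))))
      (trans (lem q _ _) (trans (cong (_+ (Σ[ quotient ] gs) * + a) e) (trans (sym (ℤ.*-distribʳ-+ (+ a) r _))
      (trans (cong (_* + a) e′) (trans (ℤ.*-assoc s (+ suc b) (+ a)) (cong (s *_) (sym (ℤ.pos-* (suc b) a))))))))))
    where
    lem : ∀ q g y → q + (g + y) ≡ (q + y) + g
    lem = solve-∀

EGZ-product : ∀ {ps} → All Prime ps → EGZ (product ps) × WeightedEGZ (product ps)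
EGZ-product [] = EGZ-1 , WeightedEGZ-1
EGZ-product {p ∷ ps} (pp ∷ pps) = multiply pp (product ps) (EGZ-product pps)
  where
  multiply : ∀ {p} → Prime p → ∀ m → EGZ m × WeightedEGZ m → EGZ (p ℕ.* m) × WeightedEGZ (p ℕ.* m)
  multiply {zero}  pp m       _           = ⊥-elim (¬prime[0] pp)
  multiply {suc k} pp zero    (egz , wegz) = subst EGZ (sym (ℕ.*-zeroʳ k)) egz , subst WeightedEGZ (sym (ℕ.*-zeroʳ k)) wegz
  multiply {suc k} pp (suc m) (egz , wegz) =
    EGZ-* {suc m} {k} egz (EGZ-prime pp) , WeightedEGZ-* {m} {k} egz (EGZ-prime pp) wegz (WeightedEGZ-prime pp)

abstract
  EGZ-theorem : ∀ m .{{_ : ℕ.NonZero m}} → EGZ m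
  EGZ-theorem m = subst EGZ (sym isFactorisation) (proj₁ (EGZ-product factorsPrime))
    where open PrimeFactorisation (factorise m)

  WeightedEGZ-theorem : ∀ m .{{_ : ℕ.NonZero m}} → WeightedEGZ m
  WeightedEGZ-theorem m = subst WeightedEGZ (sym isFactorisation) (proj₂ (EGZ-product factorsPrime))
    where open PrimeFactorisation (factorise m)

-- Products in D∞ × C₂, classes modulo ⟨x²⟩, and blocks

-- The group D∞ × C₂, of which D₂ₙ × C₂ is the quotient by x^n.
D : Set
D = ℤ × Bool × Bool

infixr 7 _∗_

_∗_ : D → D → D
(a , s , c) ∗ (b , t , d) = (if s then a - b else a + b) , s xor t , c xor d

1D : D
1D = 0ℤ , false , false

∗-assoc : ∀ x y z → (x ∗ y) ∗ z ≡ x ∗ (y ∗ z)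
∗-assoc (a , s , c) (b , t , d) (e , u , f) =
  cong₂ _,_ (first s t) (cong₂ _,_ (Bool.xor-assoc s t u) (Bool.xor-assoc c d f))
  where
  l₁ : ∀ a b e → (a + b) + e ≡ a + (b + e)
  l₁ = solve-∀
  l₂ : ∀ a b e → (a + b) - e ≡ a + (b - e)
  l₂ = solve-∀
  l₃ : ∀ a b e → (a - b) - e ≡ a - (b + e)
  l₃ = solve-∀
  l₄ : ∀ a b e → (a - b) + e ≡ a - (b - e)
  l₄ = solve-∀
  first : ∀ s t → proj₁ (((a , s , c) ∗ (b , t , d)) ∗ (e , u , f)) ≡ proj₁ ((a , s , c) ∗ ((b , t , d) ∗ (e , u , f)))
  first false false = l₁ a b e
  first false true  = l₂ a b e
  first true  false = l₃ a b e
  first true  true  = l₄ a b e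

∗-identityˡ : ∀ x → 1D ∗ x ≡ x
∗-identityˡ (a , s , c) = cong (_, s , c) (ℤ.+-identityˡ a)

-- Class (i , s , c) stands for the coset of ⟨x²⟩ containing x^i y^s z^c.
Class : Set
Class = Bool × Bool × Bool

infixr 6 _⊕_

_⊕_ : Class → Class → Class
(i , s , c) ⊕ (j , t , d) = i xor j , s xor t , c xor d

0# : Class
0# = false , false , false

⊕-assoc : ∀ κ μ ν → (κ ⊕ μ) ⊕ ν ≡ κ ⊕ (μ ⊕ ν)
⊕-assoc (i , s , c) (j , t , d) (k , u , e) =
  cong₂ _,_ (Bool.xor-assoc i j k) (cong₂ _,_ (Bool.xor-assoc s t u) (Bool.xor-assoc c d e))

⊕-comm : ∀ κ μ → κ ⊕ μ ≡ μ ⊕ κ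
⊕-comm (i , s , c) (j , t , d) =
  cong₂ _,_ (Bool.xor-comm i j) (cong₂ _,_ (Bool.xor-comm s t) (Bool.xor-comm c d))

⊕-identityʳ : ∀ κ → κ ⊕ 0# ≡ κ
⊕-identityʳ (i , s , c) = cong₂ _,_ (Bool.xor-identityʳ i) (cong₂ _,_ (Bool.xor-identityʳ s) (Bool.xor-identityʳ c))

⊕-self : ∀ κ → κ ⊕ κ ≡ 0#
⊕-self (i , s , c) = cong₂ _,_ (Bool.xor-same i) (cong₂ _,_ (Bool.xor-same s) (Bool.xor-same c))

-- (k , i , s , c) stands for x^(2k + i) y^s z^c.
E : Set
E = ℤ × Class

class : E → Class
class = proj₂

reflection : Class → Bool
reflection (_ , s , _) = s

bit : Bool → ℤ
bit b = if b then 1ℤ else 0ℤ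

exponent : E → ℤ
exponent (k , i , _) = + 2 * k + bit i

⟦_⟧ : E → D
⟦ x@(k , i , s , c) ⟧ = exponent x , s , c

∏ : List E → D
∏ = foldr (λ x → ⟦ x ⟧ ∗_) 1D

∏-++ : ∀ xs ys → ∏ (xs ++ ys) ≡ ∏ xs ∗ ∏ ys
∏-++ []       ys = sym (∗-identityˡ _)
∏-++ (x ∷ xs) ys = trans (cong (⟦ x ⟧ ∗_) (∏-++ xs ys)) (sym (∗-assoc ⟦ x ⟧ _ _))

classSum : List E → Class
classSum = foldr (λ x → class x ⊕_) 0#

classSum-++ : ∀ xs ys → classSum (xs ++ ys) ≡ classSum xs ⊕ classSum ys
classSum-++ []       ys = refl
classSum-++ (x ∷ xs) ys = trans (cong (class x ⊕_) (classSum-++ xs ys)) (sym (⊕-assoc (class x) _ _))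

classSum-↭ : ∀ {xs ys} → xs ↭ ys → classSum xs ≡ classSum ys
classSum-↭ Perm.refl        = refl
classSum-↭ (prep x σ)       = cong (class x ⊕_) (classSum-↭ σ)
classSum-↭ (swap x y σ)     = trans (sym (⊕-assoc (class x) (class y) _))
  (trans (cong₂ _⊕_ (⊕-comm (class x) (class y)) (classSum-↭ σ)) (⊕-assoc (class y) (class x) _))
classSum-↭ (Perm.trans σ τ) = trans (classSum-↭ σ) (classSum-↭ τ)

-- The quotient by ⟨x²⟩ is elementary abelian, so the class of a product does not depend on the
-- order. `carry` is what two odd exponents, or a subtracted one, pass on to the exponent of x².
∏-class : ∀ xs → ∃ λ k → ∏ xs ≡ ⟦ k , classSum xs ⟧
∏-class [] = 0ℤ , refl
∏-class ((k , i , s , c) ∷ xs) with ∏-class xs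
... | l , e rewrite e = carry s i (proj₁ (classSum xs)) , cong (_, _) (lemma s i (proj₁ (classSum xs)))
  where
  carry : Bool → Bool → Bool → ℤ
  carry false true  true  = k + l + 1ℤ
  carry false _     _     = k + l
  carry true  false true  = k - l - 1ℤ
  carry true  _     _     = k - l
  l₁ : ∀ k l → (+ 2 * k + 0ℤ) + (+ 2 * l + 0ℤ) ≡ + 2 * (k + l) + 0ℤ
  l₁ = solve-∀
  l₂ : ∀ k l → (+ 2 * k + 0ℤ) + (+ 2 * l + 1ℤ) ≡ + 2 * (k + l) + 1ℤ
  l₂ = solve-∀
  l₃ : ∀ k l → (+ 2 * k + 1ℤ) + (+ 2 * l + 0ℤ) ≡ + 2 * (k + l) + 1ℤ
  l₃ = solve-∀
  l₄ : ∀ k l → (+ 2 * k + 1ℤ) + (+ 2 * l + 1ℤ) ≡ + 2 * (k + l + 1ℤ) + 0ℤ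
  l₄ = solve-∀
  l₅ : ∀ k l → (+ 2 * k + 0ℤ) - (+ 2 * l + 0ℤ) ≡ + 2 * (k - l) + 0ℤ
  l₅ = solve-∀
  l₆ : ∀ k l → (+ 2 * k + 0ℤ) - (+ 2 * l + 1ℤ) ≡ + 2 * (k - l - 1ℤ) + 1ℤ
  l₆ = solve-∀
  l₇ : ∀ k l → (+ 2 * k + 1ℤ) - (+ 2 * l + 0ℤ) ≡ + 2 * (k - l) + 1ℤ
  l₇ = solve-∀
  l₈ : ∀ k l → (+ 2 * k + 1ℤ) - (+ 2 * l + 1ℤ) ≡ + 2 * (k - l) + 0ℤ
  l₈ = solve-∀
  lemma : ∀ s i j → (if s then (+ 2 * k + bit i) - (+ 2 * l + bit j) else (+ 2 * k + bit i) + (+ 2 * l + bit j))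
                    ≡ + 2 * carry s i j + bit (i xor j)
  lemma false false false = l₁ k l
  lemma false false true  = l₂ k l
  lemma false true  false = l₃ k l
  lemma false true  true  = l₄ k l
  lemma true  false false = l₅ k l
  lemma true  false true  = l₆ k l
  lemma true  true  false = l₇ k l
  lemma true  true  true  = l₈ k l

rotation : ℤ → D
rotation a = a , false , false

block-value : ∀ xs → classSum xs ≡ 0# → ∃ λ k → ∏ xs ≡ rotation (+ 2 * k)
block-value xs e with ∏-class xs
... | k , e′ = k , trans e′ (trans (cong (λ κ → ⟦ k , κ ⟧) e) (cong (_, _) (ℤ.+-identityʳ _)))

-- d is the weight of the block, half its length.
record Block (d : ℕ) : Set where
  constructor block
  field
    elements : List E
    size     : length elements ≡ d ℕ.* 2
    value    : ℤ
    product≡ : ∏ elements ≡ rotation (+ 2 * (value * + d))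

open Block

flatten : ∀ {d} → List (Block d) → List E
flatten = concatMap elements

∏-flatten : ∀ {d} (bs : List (Block d)) → ∏ (flatten bs) ≡ rotation (+ 2 * ((Σ[ value ] bs) * + d))
∏-flatten {d} [] = cong rotation (sym (lem (+ d)))
  where
  lem : ∀ d → + 2 * (0ℤ * d) ≡ 0ℤ
  lem = solve-∀
∏-flatten {d} (b ∷ bs) = trans (∏-++ (elements b) (flatten bs))
  (trans (cong₂ _∗_ (product≡ b) (∏-flatten bs)) (cong rotation (lem (value b) (Σ[ value ] bs) (+ d))))
  where
  lem : ∀ a b d → + 2 * (a * d) + + 2 * (b * d) ≡ + 2 * ((a + b) * d)
  lem = solve-∀

length-flatten-blocks : ∀ {d} (bs : List (Block d)) → length (flatten bs) ≡ length bs ℕ.* (d ℕ.* 2)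
length-flatten-blocks {d} = length-concatMap elements (d ℕ.* 2) size

join : ∀ {d k} → Group (value {d}) k → Block (k ℕ.* d)
join {d} {k} (group bs r l e) = block (flatten bs) size≡ r
  (trans (∏-flatten bs) (cong rotation (trans (cong (λ t → + 2 * (t * + d)) e)
    (trans (lem r (+ k) (+ d)) (cong (λ t → + 2 * (r * t)) (sym (ℤ.pos-* k d)))))))
  where
  size≡ : length (flatten bs) ≡ k ℕ.* d ℕ.* 2
  size≡ = trans (length-flatten-blocks bs) (trans (cong (ℕ._* (d ℕ.* 2)) l) (sym (ℕ.*-assoc k d 2)))
  lem : ∀ s k d → + 2 * ((s * k) * d) ≡ + 2 * (s * (k * d))
  lem = solve-∀

concatMap-concatMap : {K : Set} (f : J → List K) (g : I → List J) (xs : List I) →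
  concatMap (concatMap f ∘ g) xs ≡ concatMap f (concatMap g xs)
concatMap-concatMap f g []       = refl
concatMap-concatMap f g (x ∷ xs) =
  trans (cong (concatMap f (g x) ++_) (concatMap-concatMap f g xs)) (sym (concatMap-++ f (g x) _))

record BlockIn (d : ℕ) (S : List E) : Set where
  constructor blockIn
  field
    theBlock  : Block d
    remainder : List E
    perm      : elements theBlock ++ remainder ↭ S

-- Length 8m and exponent divisible by 2m: for n = 2m the image in D₂ₙ × C₂ is
-- a product-one sequence of length 4n.
record Solution (m : ℕ) (S : List E) : Set where
  constructor solution
  field
    chosen others : List E
    perm     : chosen ++ others ↭ S
    size     : length chosen ≡ 4 ℕ.* (m ℕ.* 2)
    quotient : ℤ
    product≡ : ∏ chosen ≡ rotation (+ 2 * (quotient * + m))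

-- `q` stands for w of the four blocks at once; w = 2 occurs when the weighted theorem has to take
-- everything.
solution-from-blocks : ∀ {m S} q w {r} → length q ≡ w ℕ.* (m ℕ.* 2) → ∏ q ≡ rotation (+ 2 * (r * + m)) →
  (bs : List (Block m)) → w ℕ.+ length bs ≡ 4 → ∀ rest → q ++ flatten bs ++ rest ↭ S → Solution m S
solution-from-blocks {m} q w {r} lq eq bs l rest σ =
  solution (q ++ flatten bs) rest (↭-trans (↭-reflexive (++-assoc q _ _)) σ) size≡ (r + Σ[ value ] bs)
    (trans (∏-++ q (flatten bs)) (trans (cong₂ _∗_ eq (∏-flatten bs)) (cong rotation (lem r (Σ[ value ] bs) (+ m)))))
  where
  size≡ : length (q ++ flatten bs) ≡ 4 ℕ.* (m ℕ.* 2)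
  size≡ = trans (length-++ q) (trans (cong₂ ℕ._+_ lq (length-flatten-blocks bs))
    (trans (sym (ℕ.*-distribʳ-+ (m ℕ.* 2) w (length bs))) (cong (ℕ._* (m ℕ.* 2)) l)))
  lem : ∀ a b d → + 2 * (a * d) + + 2 * (b * d) ≡ + 2 * ((a + b) * d)
  lem = solve-∀

solution-from-blocks₀ : ∀ {m S} (bs : List (Block m)) → length bs ≡ 4 → ∀ rest → flatten bs ++ rest ↭ S → Solution m S
solution-from-blocks₀ {m} bs l rest σ = solution-from-blocks [] 0 {0ℤ} refl (cong rotation (sym (lem (+ m)))) bs l rest σ
  where
  lem : ∀ d → + 2 * (0ℤ * d) ≡ 0ℤ
  lem = solve-∀

-- Four groups of k blocks each are found by EGZ in C_k, which needs 5k - 1 blocks.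
solution-from-many-blocks : ∀ {d k S} .{{_ : ℕ.NonZero k}} (bs : List (Block d)) rest → flatten bs ++ rest ↭ S →
  5 ℕ.* k ≤ suc (length bs) → Solution (k ℕ.* d) S
solution-from-many-blocks {d} {k} {S} bs rest σ h = assemble (extract (EGZ-theorem k) 4 value bs h)
  where
  open PermutationReasoning
  assemble : Extraction value k 4 bs → Solution (k ℕ.* d) S
  assemble (extraction gs rs τ c) = solution-from-blocks₀ (map join gs) (trans (length-map join gs) c) (flatten rs ++ rest) (begin
    flatten (map join gs) ++ flatten rs ++ rest
      ≡⟨ cong (_++ flatten rs ++ rest) (trans (concatMap-map elements join gs) (concatMap-concatMap elements members gs)) ⟩
    flatten (gather gs) ++ flatten rs ++ rest
      ≡⟨ trans (sym (++-assoc (flatten (gather gs)) _ _)) (cong (_++ rest) (sym (concatMap-++ elements (gather gs) rs))) ⟩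
    flatten (gather gs ++ rs) ++ rest
      ↭⟨ ++⁺ʳ rest (concatMap-↭ elements τ) ⟩
    flatten bs ++ rest
      ↭⟨ σ ⟩
    S ∎)

-- Pairing off, and affine planes of classes

record Pair : Set where
  constructor pair
  field
    fst snd : E
    same    : class fst ≡ class snd

open Pair

twoElements : Pair → List E
twoElements (pair x y _) = x ∷ y ∷ []

_≟ᶜ_ : DecidableEquality Class
(i , s , c) ≟ᶜ (j , t , d) =
  map′ (λ { (refl , refl , refl) → refl }) (λ { refl → refl , refl , refl })
    ((i Bool.≟ j) ×-dec (s Bool.≟ t) ×-dec (c Bool.≟ d))

DistinctClasses : List E → Set
DistinctClasses = AllPairs (λ x y → class x ≢ class y)

AllPairs-resp-↭ : {R : I → I → Set} → (∀ {x y} → R x y → R y x) → ∀ {xs ys} → xs ↭ ys → AllPairs R xs → AllPairs R ys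
AllPairs-resp-↭ sy Perm.refl        rs                     = rs
AllPairs-resp-↭ sy (prep x σ)       (r ∷ rs)               = All-resp-↭ σ r ∷ AllPairs-resp-↭ sy σ rs
AllPairs-resp-↭ sy (swap x y σ)     ((r ∷ r₁) ∷ r₂ ∷ rs) =
  (sy r ∷ All-resp-↭ σ r₂) ∷ All-resp-↭ σ r₁ ∷ AllPairs-resp-↭ sy σ rs
AllPairs-resp-↭ sy (Perm.trans σ τ) rs                     = AllPairs-resp-↭ sy τ (AllPairs-resp-↭ sy σ rs)

pair-up : ∀ S → ∃₂ λ prs L → concatMap twoElements prs ++ L ↭ S × DistinctClasses L
pair-up [] = [] , [] , ↭-refl , []
pair-up (x ∷ S) with pair-up S
... | prs , L , σ , dist with Any.any? (λ y → class x ≟ᶜ class y) L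
...   | no new = prs , x ∷ L , ↭-trans (shift x (concatMap twoElements prs) L) (prep x σ) , All.¬Any⇒All¬ L new ∷ dist
...   | yes w with split-off w
...     | y , L′ , e , τ = pair x y e ∷ prs , L′
          , prep x (↭-trans (↭-sym (shift y (concatMap twoElements prs) L′)) (↭-trans (++⁺ˡ (concatMap twoElements prs) τ) σ))
          , AllPairs.tail (AllPairs-resp-↭ (_∘ sym) (↭-sym τ) dist)

complement : {C D : List I} → AllPairs _≢_ C → All (_∈ D) C → ∃ λ M → C ++ M ↭ D
complement {D = D} [] [] = D , ↭-refl
complement {C = c ∷ C} (c∉C ∷ distinct) (c∈D ∷ C⊆D) with split-off c∈D
... | .c , D′ , refl , τ with complement {D = D′} distinct (All.zipWith in-D′ (c∉C , C⊆D))
  where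
  in-D′ : ∀ {x} → c ≢ x × x ∈ _ → x ∈ D′
  in-D′ (c≢x , x∈D) with ∈-resp-↭ (↭-sym τ) x∈D
  ... | here x≡c = ⊥-elim (c≢x (sym x≡c))
  ... | there x∈D′ = x∈D′
...   | M , σ = M , ↭-trans (prep c σ) τ

classes : List Class
classes = concatMap (λ i → concatMap (λ s → map (λ c → i , s , c) bools) bools) bools
  where
  bools = false ∷ true ∷ []

∈-classes : ∀ κ → κ ∈ classes
∈-classes (false , false , false) = here refl
∈-classes (false , false , true)  = there (here refl)
∈-classes (false , true  , false) = there (there (here refl))
∈-classes (false , true  , true)  = there (there (there (here refl)))
∈-classes (true  , false , false) = there (there (there (there (here refl))))
∈-classes (true  , false , true)  = there (there (there (there (there (here refl)))))
∈-classes (true  , true  , false) = there (there (there (there (there (there (here refl))))))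
∈-classes (true  , true  , true)  = there (there (there (there (there (there (there (here refl)))))))

missing-classes : ∀ L → DistinctClasses L → ∃ λ M → map class L ++ M ↭ classes
missing-classes L dist = complement (AllPairs.map⁺ dist) (All.universal ∈-classes (map class L))

map-++-inv : (f : I → J) (ks ns : List J) {zs : List I} → ks ++ ns ≡ map f zs →
  ∃₂ λ xs ys → xs ++ ys ≡ zs × map f xs ≡ ks
map-++-inv f []       ns {zs} e = [] , zs , refl , refl
map-++-inv f (k ∷ ks) ns {z ∷ zs} e with map-++-inv f ks ns (∷-injectiveʳ e)
... | xs , ys , refl , refl = z ∷ xs , ys , refl , cong (_∷ map f xs) (sym (∷-injectiveˡ e))

pick-classes : ∀ {L M} → map class L ++ M ↭ classes → ∀ {ks} → AllPairs _≢_ ks → All (λ κ → ¬ κ ∈ M) ks →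
  ∃₂ λ xs R → xs ++ R ↭ L × map class xs ≡ ks
pick-classes {L} {M} σ {ks} distinct avoid with complement {D = map class L} distinct (All.map present avoid)
  where
  present : ∀ {κ} → ¬ κ ∈ M → κ ∈ map class L
  present {κ} κ∉M with ∈-++⁻ (map class L) (∈-resp-↭ (↭-sym σ) (∈-classes κ))
  ... | inj₁ κ∈L = κ∈L
  ... | inj₂ κ∈M = ⊥-elim (κ∉M κ∈M)
... | N , τ with ↭-map-inv class (↭-sym τ)
...   | zs , e , ρ with map-++-inv class ks N e
...     | xs , R , refl , e′ = xs , R , ↭-sym ρ , e′

sumClasses : List Class → Class
sumClasses = foldr _⊕_ 0#

classSum-map : ∀ xs → classSum xs ≡ sumClasses (map class xs)
classSum-map []       = refl
classSum-map (x ∷ xs) = cong (class x ⊕_) (classSum-map xs)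

IsPlane : List Class → Set
IsPlane ks = AllPairs _≢_ ks × sumClasses ks ≡ 0#

isPlane? : ∀ ks → Dec (IsPlane ks)
isPlane? ks = AllPairs.allPairs? (λ κ μ → ¬? (κ ≟ᶜ μ)) ks ×-dec (sumClasses ks ≟ᶜ 0#)

plane : Class → Class → Class → List Class
plane κ μ ν = κ ∷ κ ⊕ μ ∷ κ ⊕ ν ∷ κ ⊕ μ ⊕ ν ∷ []

Avoids : List Class → List Class → Set
Avoids M ks = All (λ κ → ¬ κ ∈ M) ks

avoids? : ∀ M ks → Dec (Avoids M ks)
avoids? M ks = All.all? (λ κ → ¬? (DecMembership._∈?_ _≟ᶜ_ κ M)) ks

∃-class? : {P : Class → Set} → (∀ κ → Dec (P κ)) → Dec (∃ P)
∃-class? P? = map′ (λ w → _ , proj₂ (proj₂ (find w))) (λ (κ , pκ) → lose (∈-classes κ) pκ) (Any.any? P? classes)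

∀-class? : {P : Class → Set} → (∀ κ → Dec (P κ)) → Dec (∀ κ → P κ)
∀-class? P? = map′ (λ ps κ → All.lookup ps (∈-classes κ)) (λ ps → All.universal ps classes) (All.all? P? classes)

-- The fourteen affine planes of F₂³: each of the seven two-dimensional subspaces ⟨μ, ν⟩, and its
-- translate by a vector κ outside it.
planes : List (Class × Class × Class)
planes = concatMap parallel
  ((e₃ , e₁ , e₂) ∷ (e₂ , e₁ , e₃) ∷ (e₁ , e₂ , e₃) ∷ (e₂ , e₁ , e₂ ⊕ e₃) ∷
   (e₁ , e₂ , e₁ ⊕ e₃) ∷ (e₁ , e₃ , e₁ ⊕ e₂) ∷ (e₁ , e₁ ⊕ e₂ , e₂ ⊕ e₃) ∷ [])
  where
  e₁ e₂ e₃ : Class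
  e₁ = true , false , false
  e₂ = false , true , false
  e₃ = false , false , true
  parallel : Class × Class × Class → List (Class × Class × Class)
  parallel (κ , μ , ν) = (0# , μ , ν) ∷ (κ , μ , ν) ∷ []

⊕-cancel : ∀ κ μ → κ ⊕ (κ ⊕ μ) ≡ μ
⊕-cancel κ μ = trans (sym (⊕-assoc κ κ μ)) (cong (_⊕ μ) (⊕-self κ))

⊕-cancel′ : ∀ κ {μ ν} → κ ⊕ μ ≡ ν → μ ≡ κ ⊕ ν
⊕-cancel′ κ {μ} e = trans (sym (⊕-cancel κ μ)) (cong (κ ⊕_) e)

abstract
  all-planes : All (λ (_ , μ , ν) → ∀ κ → IsPlane (plane κ μ ν)) planes
  all-planes = from-yes (All.all? (λ (_ , μ , ν) → ∀-class? λ κ → isPlane? (plane κ μ ν)) planes)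

  -- Any three points lie in a plane, and the parallel plane avoids them. The finitely many cases
  -- are checked by evaluation.
  plane-avoiding-origin : ∀ b c → Any (λ (κ , μ , ν) → Avoids (0# ∷ b ∷ c ∷ []) (plane κ μ ν)) planes
  plane-avoiding-origin = from-yes (∀-class? λ b → ∀-class? λ c →
    Any.any? (λ (κ , μ , ν) → avoids? (0# ∷ b ∷ c ∷ []) (plane κ μ ν)) planes)

-- Translating by a, one of the three points to be avoided is the origin.
plane-avoiding-three : ∀ a b c → ∃ λ ks → IsPlane ks × length ks ≡ 4 × Avoids (a ∷ b ∷ c ∷ []) ks
plane-avoiding-three a b c with find (plane-avoiding-origin (a ⊕ b) (a ⊕ c))
... | (κ , μ , ν) , π∈planes , avoids =
  plane (a ⊕ κ) μ ν , All.lookup all-planes π∈planes (a ⊕ κ) , refl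
  , subst (Avoids (a ∷ b ∷ c ∷ [])) (sym translate) (All.map⁺ (All.map avoid avoids))
  where
  translate : plane (a ⊕ κ) μ ν ≡ map (a ⊕_) (plane κ μ ν)
  translate = cong (a ⊕ κ ∷_) (cong₂ _∷_ (⊕-assoc a κ μ) (cong₂ _∷_ (⊕-assoc a κ ν) (cong (_∷ []) (⊕-assoc a κ (μ ⊕ ν)))))
  avoid : ∀ {κ} → ¬ κ ∈ 0# ∷ a ⊕ b ∷ a ⊕ c ∷ [] → ¬ a ⊕ κ ∈ a ∷ b ∷ c ∷ []
  avoid κ∉ (here e)                 = κ∉ (here (trans (⊕-cancel′ a e) (⊕-self a)))
  avoid κ∉ (there (here e))         = κ∉ (there (here (⊕-cancel′ a e)))
  avoid κ∉ (there (there (here e))) = κ∉ (there (there (here (⊕-cancel′ a e))))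

abstract
  -- The odd exponent is what settles p = 2: moving the rotation of class κ across a reflection
  -- changes the value by that exponent, which 2 does not divide.
  plane-with-odd-rotation : ∀ w → ∃ λ κ → ∃ λ μ → ∃ λ ν →
    (IsPlane (plane κ μ ν) × Avoids (w ∷ []) (plane κ μ ν)) × proj₁ κ ≡ true × map reflection (plane κ μ ν) ≡ false ∷ false ∷ true ∷ true ∷ []
  plane-with-odd-rotation = from-yes (∀-class? λ w → ∃-class? λ κ → ∃-class? λ μ → ∃-class? λ ν →
    (isPlane? (plane κ μ ν) ×-dec avoids? (w ∷ []) (plane κ μ ν)) ×-dec (proj₁ κ Bool.≟ true)
      ×-dec ≡-decᴸ Bool._≟_ (map reflection (plane κ μ ν)) (false ∷ false ∷ true ∷ true ∷ []))

  -- Translation by μ splits the four classes of reflections into two pairs, and `w` meets at most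
  -- one of them.
  reflections-with-difference : ∀ w μ → reflection μ ≡ false → μ ≢ 0# → ∃ λ κ →
    (AllPairs _≢_ (κ ∷ κ ⊕ μ ∷ []) × Avoids (w ∷ []) (κ ∷ κ ⊕ μ ∷ [])) × reflection κ ≡ true
  reflections-with-difference = from-yes (∀-class? λ w → ∀-class? λ μ → (reflection μ Bool.≟ false) →-dec (¬? (μ ≟ᶜ 0#) →-dec
    ∃-class? λ κ → (AllPairs.allPairs? (λ κ μ → ¬? (κ ≟ᶜ μ)) (κ ∷ κ ⊕ μ ∷ []) ×-dec avoids? (w ∷ []) (κ ∷ κ ⊕ μ ∷ []))
      ×-dec (reflection κ Bool.≟ true)))

-- Inverting words between two reflections

isReflection : D → Bool
isReflection (_ , s , _) = s

exponent-rotation-∗ : ∀ x y → isReflection x ≡ false → proj₁ (x ∗ y) ≡ proj₁ x + proj₁ y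
exponent-rotation-∗ (_ , false , _) y refl = refl

exponent-reflection-∗ : ∀ x y → isReflection x ≡ true → proj₁ (x ∗ y) ≡ proj₁ x - proj₁ y
exponent-reflection-∗ (_ , true , _) y refl = refl

-- Two kinds of words occur: a single rotation, and a whole pair, whose product is a rotation even
-- when its members are reflections.
module _ {I : Set} (word : I → List E) where

  AllRotations : List I → Set
  AllRotations = All (λ w → isReflection (∏ (word w)) ≡ false)

  wordExponent : I → ℤ
  wordExponent w = proj₁ (∏ (word w))

  isReflection-words : ∀ {ws} → AllRotations ws → isReflection (∏ (concatMap word ws)) ≡ false
  isReflection-words []                  = refl
  isReflection-words {w ∷ ws} (r ∷ rs) =
    trans (cong isReflection (∏-++ (word w) _)) (cong₂ _xor_ r (isReflection-words rs))

  exponent-words : ∀ {ws} → AllRotations ws → proj₁ (∏ (concatMap word ws)) ≡ Σ[ wordExponent ] ws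
  exponent-words []                = refl
  exponent-words {w ∷ ws} (r ∷ rs) = trans (cong proj₁ (∏-++ (word w) _))
    (trans (exponent-rotation-∗ (∏ (word w)) (∏ (concatMap word ws)) r) (cong (_+_ (wordExponent w)) (exponent-words rs)))

  negated kept : List (I × Bool) → List I
  negated []               = []
  negated ((w , true) ∷ cs)  = w ∷ negated cs
  negated ((w , false) ∷ cs) = negated cs
  kept []               = []
  kept ((w , true) ∷ cs)  = kept cs
  kept ((w , false) ∷ cs) = w ∷ kept cs

  negated-kept-↭ : ∀ cs → negated cs ++ kept cs ↭ map proj₁ cs
  negated-kept-↭ []                 = ↭-refl
  negated-kept-↭ ((w , true) ∷ cs)  = prep w (negated-kept-↭ cs)
  negated-kept-↭ ((w , false) ∷ cs) = ↭-trans (shift w (negated cs) (kept cs)) (prep w (negated-kept-↭ cs))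

  module _ {p : ℕ} (pp : Prime p) (p∤2 : ¬ + p ∣ + 2) where

    Σ-signs : ∀ cs → Σ[ slotValue (λ w → - wordExponent w) wordExponent ] cs
                     ≡ Σ[ wordExponent ] kept cs - Σ[ wordExponent ] negated cs
    Σ-signs []                 = refl
    Σ-signs ((w , true) ∷ cs)  = trans (cong (_+_ (- wordExponent w)) (Σ-signs cs)) (lem (wordExponent w) (Σ[ wordExponent ] kept cs) (Σ[ wordExponent ] negated cs))
      where
      lem : ∀ a k n → - a + (k - n) ≡ k - (a + n)
      lem = solve-∀
    Σ-signs ((w , false) ∷ cs) = trans (cong (_+_ (wordExponent w)) (Σ-signs cs)) (lem (wordExponent w) (Σ[ wordExponent ] kept cs) (Σ[ wordExponent ] negated cs))
      where
      lem : ∀ a k n → a + (k - n) ≡ (a + k) - n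
      lem = solve-∀

    -- Words placed between the reflections u and v are inverted, so the
    -- exponent of u N v P F is that of u v F plus a signed sum.
    signed-block : ∀ u v (ws : List I) F → reflection (class u) ≡ true → reflection (class v) ≡ true →
      AllRotations ws → All (λ w → ¬ + p ∣ wordExponent w) ws → p ≤ suc (length ws) →
      classSum (u ∷ v ∷ concatMap word ws ++ F) ≡ 0# → length (u ∷ v ∷ concatMap word ws ++ F) ≡ p ℕ.* 2 →
      ∃ λ (b : Block p) → elements b ↭ u ∷ v ∷ concatMap word ws ++ F
    signed-block u v ws F ref-u ref-v rots nonzero enough cls len =
      -- Each word is a slot offering - a and a, which are incongruent because p is odd. At least p
      -- - 1 slots reach every residue, hence - c.
      build (choices-hit pp _ _ ws (All.map (λ {w} → incongruent {w}) nonzero) (- c ∷ []) (s≤s z≤n) ([] ∷ []) enough)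
      where
      c : ℤ
      c = exponent u - exponent v + proj₁ (∏ F)

      incongruent : ∀ {w} → ¬ + p ∣ wordExponent w → ¬ - wordExponent w ≈ wordExponent w [ p ]
      incongruent {w} n (congruent d) = n (halve pp p∤2 _ (∣-resp (lem (wordExponent w)) (∣m⇒∣-m d)))
        where
        lem : ∀ a → - (- a - a) ≡ + 2 * a
        lem = solve-∀

      build : (∃ λ cs → map proj₁ cs ≡ ws × Any (λ t → t ≈ Σ[ slotValue (λ w → - wordExponent w) wordExponent ] cs [ p ]) (- c ∷ [])) →
        ∃ λ (b : Block p) → elements b ↭ u ∷ v ∷ concatMap word ws ++ F
      build (cs , refl , here (congruent d)) = finish (block-value arranged (trans (classSum-↭ perm) cls))
        where
        N = concatMap word (negated cs)
        P = concatMap word (kept cs)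
        arranged = u ∷ N ++ v ∷ P ++ F

        perm : arranged ↭ u ∷ v ∷ concatMap word ws ++ F
        perm = prep u (↭-trans (shift v N (P ++ F)) (prep v
          (↭-trans (↭-reflexive (sym (++-assoc N P F))) (++⁺ʳ F
            (↭-trans (↭-reflexive (sym (concatMap-++ word (negated cs) (kept cs)))) (concatMap-↭ word (negated-kept-↭ cs)))))))

        both-rots : AllRotations (negated cs) × AllRotations (kept cs)
        both-rots = let rots′ = All-resp-↭ (↭-sym (negated-kept-↭ cs)) rots in
          All.++⁻ˡ (negated cs) rots′ , All.++⁻ʳ (negated cs) rots′

        exponent≡ : proj₁ (∏ arranged) ≡ c + (Σ[ wordExponent ] kept cs - Σ[ wordExponent ] negated cs)
        exponent≡ = trans (exponent-reflection-∗ ⟦ u ⟧ (∏ (N ++ v ∷ P ++ F)) ref-u)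
          (trans (cong (λ e → exponent u - e) (trans (after (negated cs) (v ∷ P ++ F) (proj₁ both-rots))
            (cong (_+_ (Σ[ wordExponent ] negated cs)) (trans (exponent-reflection-∗ ⟦ v ⟧ (∏ (P ++ F)) ref-v)
              (cong (λ e → exponent v - e) (after (kept cs) F (proj₂ both-rots)))))))
            (lem (exponent u) (Σ[ wordExponent ] negated cs) (exponent v) (Σ[ wordExponent ] kept cs) (proj₁ (∏ F))))
          where
          after : ∀ ws ys → AllRotations ws → proj₁ (∏ (concatMap word ws ++ ys)) ≡ Σ[ wordExponent ] ws + proj₁ (∏ ys)
          after ws ys rs = trans (cong proj₁ (∏-++ (concatMap word ws) ys))
            (trans (exponent-rotation-∗ (∏ (concatMap word ws)) (∏ ys) (isReflection-words rs)) (cong (_+ proj₁ (∏ ys)) (exponent-words rs)))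
          lem : ∀ u n v k f → u - (n + (v - (k + f))) ≡ (u - v + f) + (k - n)
          lem = solve-∀

        finish : (∃ λ k → ∏ arranged ≡ rotation (+ 2 * k)) → _
        -- The vanishing class sum makes the exponent even, equal to 2k; since p is odd,
        -- divisibility passes to k.
        finish (k , e) = conclude (halve pp p∤2 k (∣-resp even≡ (∣m⇒∣-m d)))
          where
          even≡ : - (- c - Σ[ slotValue (λ w → - wordExponent w) wordExponent ] cs) ≡ + 2 * k
          even≡ = trans (lem c _) (trans (cong (_+_ c) (Σ-signs cs)) (trans (sym exponent≡) (cong proj₁ e)))
            where
            lem : ∀ c s → - (- c - s) ≡ c + s
            lem = solve-∀
          conclude : + p ∣ k → ∃ λ (b : Block p) → elements b ↭ u ∷ v ∷ concatMap word ws ++ F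
          conclude (divides r e′) = block arranged (trans (↭-length perm) len) r
            (trans e (cong (λ k → rotation (+ 2 * k)) e′)) , perm

-- Blocks made of pairs and one quadruple

unpair : List Pair → List E
unpair = concatMap twoElements

classSum-pair : ∀ π → classSum (twoElements π) ≡ 0#
classSum-pair (pair x y e) = trans (cong (_⊕ (class y ⊕ 0#)) e)
  (trans (cong (class y ⊕_) (⊕-identityʳ (class y))) (⊕-self (class y)))

classSum-pairs : ∀ prs → classSum (unpair prs) ≡ 0#
classSum-pairs []        = refl
classSum-pairs (π ∷ prs) = trans (classSum-++ (twoElements π) (unpair prs)) (cong₂ _⊕_ (classSum-pair π) (classSum-pairs prs))

abstract
  pair-value : ∀ π → ∃ λ k → ∏ (twoElements π) ≡ rotation (+ 2 * k)
  pair-value π = block-value (twoElements π) (classSum-pair π)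

pairValue : Pair → ℤ
pairValue π = proj₁ (pair-value π)

∏-pair : ∀ π → ∏ (twoElements π) ≡ rotation (+ 2 * pairValue π)
∏-pair π = proj₂ (pair-value π)

∏-pairs : ∀ prs → ∏ (unpair prs) ≡ rotation (+ 2 * Σ[ pairValue ] prs)
∏-pairs []        = refl
∏-pairs (π ∷ prs) = trans (∏-++ (twoElements π) (unpair prs))
  (trans (cong₂ _∗_ (∏-pair π) (∏-pairs prs)) (cong rotation (lem (pairValue π) (Σ[ pairValue ] prs))))
  where
  lem : ∀ a b → + 2 * a + + 2 * b ≡ + 2 * (a + b)
  lem = solve-∀

length-pairs : ∀ prs → length (unpair prs) ≡ length prs ℕ.* 2
length-pairs = length-concatMap twoElements 2 (λ _ → refl)

block-of-pairs : ∀ {d} q w {r} → length q ≡ w ℕ.* 2 → ∏ q ≡ rotation (+ 2 * r) → ∀ prs → w ℕ.+ length prs ≡ d →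
  + d ∣ r + Σ[ pairValue ] prs → Block d
block-of-pairs {d} q w {r} lq eq prs l (divides s e) = block (q ++ unpair prs)
  (trans (length-++ q) (trans (cong₂ ℕ._+_ lq (length-pairs prs)) (trans (sym (ℕ.*-distribʳ-+ 2 w (length prs))) (cong (ℕ._* 2) l))))
  s (trans (∏-++ q (unpair prs)) (trans (cong₂ _∗_ eq (∏-pairs prs)) (cong rotation (trans (lem r (Σ[ pairValue ] prs)) (cong (+ 2 *_) e)))))
  where
  lem : ∀ a b → + 2 * a + + 2 * b ≡ + 2 * (a + b)
  lem = solve-∀

block-of-pairs₀ : ∀ {d} prs → length prs ≡ d → + d ∣ Σ[ pairValue ] prs → Block d
block-of-pairs₀ prs l d = block-of-pairs [] 0 {0ℤ} refl refl prs l (∣-resp (sym (ℤ.+-identityˡ _)) d)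

pairs-split : ∀ {ys zs prs} → ys ++ zs ↭ prs → unpair ys ++ unpair zs ↭ unpair prs
pairs-split {ys} {zs} σ = ↭-trans (↭-reflexive (sym (concatMap-++ twoElements ys zs))) (concatMap-↭ twoElements σ)

vanishing⇒block : ∀ {d prs} L → VanishingSubset d pairValue d prs → BlockIn d (unpair prs ++ L)
vanishing⇒block L (ys , zs , σ , l , d) = blockIn (block-of-pairs₀ ys l d) (unpair zs ++ L)
  (↭-trans (↭-reflexive (sym (++-assoc (unpair ys) _ L))) (++⁺ʳ L (pairs-split {ys} {zs} σ)))

with-quad⇒block : ∀ {d prs L} q R {r} → q ++ R ↭ L → length q ≡ 4 → ∏ q ≡ rotation (+ 2 * r) →
  ∀ ys zs → ys ++ zs ↭ prs → 2 ℕ.+ length ys ≡ d → + d ∣ r + Σ[ pairValue ] ys → BlockIn d (unpair prs ++ L)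
with-quad⇒block {prs = prs} {L} q R ρ lq eq ys zs σ l d =
  blockIn (block-of-pairs q 2 lq eq ys l d) (unpair zs ++ R) (begin
    (q ++ unpair ys) ++ unpair zs ++ R
      ↭⟨ ↭-Solver.solve 4 (λ q y z r → (q ⊕′ y) ⊕′ (z ⊕′ r) ⊜ (y ⊕′ z) ⊕′ (q ⊕′ r)) ↭-refl q (unpair ys) (unpair zs) R ⟩
    (unpair ys ++ unpair zs) ++ (q ++ R)
      ↭⟨ ++⁺ (pairs-split {ys} {zs} σ) ρ ⟩
    unpair prs ++ L ∎)
  where
  open PermutationReasoning
  open ↭-Solver using (_⊜_) renaming (_⊕_ to _⊕′_)

-- Let p = k + 2. Unless p of the at least 2p - 3 pairs vanish, the sums of p - 2 pairs miss at most
-- one residue, so they meet one of the two targets - r and - r′.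
two-values⇒block : ∀ {k prs L} → Prime (2+ k) → 2+ k ℕ.+ k ≤ suc (length prs) →
  ∀ q q′ R r r′ → q ++ R ↭ L → q′ ↭ q → length q ≡ 4 → ∏ q ≡ rotation (+ 2 * r) → ∏ q′ ≡ rotation (+ 2 * r′) →
  ¬ r ≈ r′ [ 2+ k ] → BlockIn (2+ k) (unpair prs ++ L)
two-values⇒block {k} {prs} {L} pp h q q′ R r r′ ρ ρ′ lq eq eq′ r≉r′ =
  [ vanishing⇒block L , use ]′ (subset-sums (2+ k) pairValue pp k prs (ℕ.≤-trans (ℕ.n<1+n k) (ℕ.n≤1+n _)) h)
  where
  neg : ∀ a s → - (- a - s) ≡ a + s
  neg = solve-∀
  neg-diff : ∀ a b → - (- a - - b) ≡ a - b
  neg-diff = solve-∀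
  distinct : ¬ - r ≈ - r′ [ 2+ k ]
  distinct (congruent d) = r≉r′ (congruent (∣-resp (neg-diff r r′) (∣m⇒∣-m d)))
  finish : ∀ ys zs → ys ++ zs ↭ prs → length ys ≡ k → Any (λ t → t ≈ Σ[ pairValue ] ys [ 2+ k ]) (- r ∷ - r′ ∷ []) →
    BlockIn (2+ k) (unpair prs ++ L)
  finish ys zs σ l (here (congruent d)) = with-quad⇒block q R {r} ρ lq eq ys zs σ (cong 2+ l) (∣-resp (neg r _) (∣m⇒∣-m d))
  finish ys zs σ l (there (here (congruent d))) =
    with-quad⇒block q′ R {r′} (↭-trans (++⁺ʳ R ρ′) ρ) (trans (↭-length ρ′) lq) eq′ ys zs σ (cong 2+ l) (∣-resp (neg r′ _) (∣m⇒∣-m d))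
  use : ((T : List ℤ) → 0 < length T → AllPairs (λ x y → ¬ x ≈ y [ 2+ k ]) T → 2+ k ≤ length T ℕ.+ k →
      ∃₂ λ ys zs → ys ++ zs ↭ prs × length ys ≡ k × Any (λ t → t ≈ Σ[ pairValue ] ys [ 2+ k ]) T) →
      BlockIn (2+ k) (unpair prs ++ L)
  use sums = let ys , zs , σ , l , hit = sums (- r ∷ - r′ ∷ []) (s≤s z≤n) ((distinct ∷ []) ∷ [] ∷ []) ℕ.≤-refl
             in finish ys zs σ l hit

-- Permuting r r′ u v moves its exponent r + r′ + u - v by 2 r, 2 r′ or 2 (u - v).
quad-shift⇒block : ∀ {k prs L} → Prime (2+ k) → 2+ k ℕ.+ k ≤ suc (length prs) →
  ∀ q q′ R → q ++ R ↭ L → q′ ↭ q → length q ≡ 4 → classSum q ≡ 0# → ∀ δ → proj₁ (∏ q) - proj₁ (∏ q′) ≡ + 2 * δ →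
  ¬ + 2+ k ∣ δ → BlockIn (2+ k) (unpair prs ++ L)
quad-shift⇒block {k} {prs} {L} pp h q q′ R ρ ρ′ lq cls δ diff ∤δ =
  use (block-value q cls) (block-value q′ (trans (classSum-↭ ρ′) cls))
  where
  use : (∃ λ r → ∏ q ≡ rotation (+ 2 * r)) → (∃ λ r → ∏ q′ ≡ rotation (+ 2 * r)) → BlockIn (2+ k) (unpair prs ++ L)
  use (r , e) (r′ , e′) = two-values⇒block {prs = prs} pp h q q′ R r r′ ρ ρ′ lq e e′ λ (congruent d) → ∤δ (∣-resp r-r′≡δ d)
    where
    lem : ∀ a b → + 2 * a - + 2 * b ≡ + 2 * (a - b)
    lem = solve-∀
    r-r′≡δ : r - r′ ≡ δ
    r-r′≡δ = ℤ.*-cancelˡ-≡ (+ 2) _ _ (trans (sym (lem r r′)) (trans (cong₂ _-_ (sym (cong proj₁ e)) (sym (cong proj₁ e′))) diff))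

dec-partition : {P : I → Set} → (∀ x → Dec (P x)) → ∀ xs → ∃₂ λ ys zs → ys ++ zs ↭ xs × All P ys × All (λ x → ¬ P x) zs
dec-partition P? [] = [] , [] , ↭-refl , [] , []
dec-partition P? (x ∷ xs) with P? x | dec-partition P? xs
... | yes px | ys , zs , σ , ps , ns = x ∷ ys , zs , prep x σ , px ∷ ps , ns
... | no ¬px | ys , zs , σ , ps , ns = ys , x ∷ zs , ↭-trans (shift x ys zs) (prep x σ) , ps , ¬px ∷ ns

∣-Σ : ∀ {d} (v : I → ℤ) {xs} → All (λ x → + d ∣ v x) xs → + d ∣ Σ[ v ] xs
∣-Σ v []       = divides 0ℤ refl
∣-Σ v (d ∷ ds) = ∣m∣n⇒∣m+n d (∣-Σ v ds)

-- A quadruple of value 0 modulo an odd prime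

rotation-pair-exponent : ∀ π → reflection (class (fst π)) ≡ false → + 2 * pairValue π ≡ exponent (fst π) + exponent (snd π)
rotation-pair-exponent π@(pair (k , i , _ , c) (l , .i , _ , .c) refl) refl =
  trans (sym (cong proj₁ (∏-pair π))) (cong (_+_ (exponent (k , i , false , c))) (ℤ.+-identityʳ _))

swapPair : Pair → Pair
swapPair (pair x y e) = pair y x (sym e)

module OddPrime {h : ℕ} (pp : Prime (3 ℕ.+ h)) (p∤2 : ¬ + (3 ℕ.+ h) ∣ + 2) where

  p = 3 ℕ.+ h

  GoodRotations : Pair → Set
  GoodRotations π = reflection (class (fst π)) ≡ false × ¬ + p ∣ exponent (fst π)

  -- The exponents of two paired rotations add up to twice the value of the pair, which is nonzero
  -- modulo the odd prime p. So one of them is nonzero, and it is put first.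
  orient : ∀ prs → All (λ π → ¬ + p ∣ pairValue π) prs → All (λ π → reflection (class (fst π)) ≡ false) prs →
    ∃ λ prs′ → unpair prs′ ↭ unpair prs × length prs′ ≡ length prs × All GoodRotations prs′
  orient [] [] [] = [] , ↭-refl , refl , []
  orient (π ∷ prs) (n ∷ ns) (r ∷ rs) = add (orient prs ns rs) (+ p ∣? exponent (fst π))
    where
    add : (∃ λ prs′ → unpair prs′ ↭ unpair prs × length prs′ ≡ length prs × All GoodRotations prs′) →
      Dec (+ p ∣ exponent (fst π)) →
      ∃ λ prs′ → unpair prs′ ↭ unpair (π ∷ prs) × length prs′ ≡ length (π ∷ prs) × All GoodRotations prs′
    add (prs′ , σ , l , gs) (no p∤x) = π ∷ prs′ , prep _ (prep _ σ) , cong suc l , (r , p∤x) ∷ gs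
    add (prs′ , σ , l , gs) (yes p∣x) = swapPair π ∷ prs′ , swap _ _ σ , cong suc l
      , (trans (cong reflection (sym (same π))) r
        , λ p∣y → n (halve pp p∤2 _ (∣-resp (sym (rotation-pair-exponent π r)) (∣m∣n⇒∣m+n p∣x p∣y)))) ∷ gs

  firsts-seconds : ∀ prs → map fst prs ++ map snd prs ↭ unpair prs
  firsts-seconds []        = ↭-refl
  firsts-seconds (π ∷ prs) = prep (fst π) (↭-trans (shift (snd π) (map fst prs) (map snd prs)) (prep (snd π) (firsts-seconds prs)))

  placed : ∀ {S X rest} → (∃ λ (b : Block p) → elements b ↭ X) → X ++ rest ↭ S → BlockIn p S
  placed {rest = rest} (b , σ) τ = blockIn b rest (↭-trans (++⁺ʳ rest σ) τ)

  GoodRotation : E → Set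
  GoodRotation x = reflection (class x) ≡ false × ¬ + p ∣ exponent x

  -- One rotation of each pair is used as a word with a free sign.
  signed-rotations⇒block : ∀ {S} u v → reflection (class u) ≡ true → reflection (class v) ≡ true →
    ∀ c₁ c₂ → GoodRotation c₁ → GoodRotation c₂ → ∀ prs → length prs ≡ h → All GoodRotations prs →
    ∀ F → length F ≡ 2 → classSum (u ∷ v ∷ c₁ ∷ c₂ ∷ []) ⊕ classSum F ≡ 0# →
    ∀ rest → (u ∷ v ∷ c₁ ∷ c₂ ∷ []) ++ F ++ unpair prs ++ rest ↭ S → BlockIn p S
  signed-rotations⇒block {S} u v ref-u ref-v c₁ c₂ g₁ g₂ prs refl gs F lF cls rest σ =
    placed (signed-block (_∷ []) pp p∤2 u v cs (F ++ map snd prs) ref-u ref-v rots nonzero enough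
              (trans (classSum-↭ perm) classSum≡) (trans (↭-length perm) length≡))
      (↭-trans (++⁺ʳ rest perm) (↭-trans (↭-reflexive (cong (λ t → u ∷ v ∷ c₁ ∷ c₂ ∷ t)
        (++-assoc F (unpair prs) rest))) σ))
    where
    cs : List E
    cs = c₁ ∷ c₂ ∷ map fst prs

    good : All GoodRotation cs
    good = g₁ ∷ g₂ ∷ All.map⁺ gs

    rots : AllRotations (_∷ []) cs
    rots = All.map (λ {x} (r , _) → trans (Bool.xor-identityʳ _) r) good

    nonzero : All (λ x → ¬ + p ∣ wordExponent (_∷ []) x) cs
    nonzero = All.map (λ {x} (r , n) d → n (∣-resp (trans (exponent-rotation-∗ ⟦ x ⟧ 1D r) (ℤ.+-identityʳ _)) d)) good

    -- c₁, c₂ and one rotation from each of the h pairs are h + 2 = p - 1 words. With the partners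
    -- in these pairs, u, v and the two fillers `F`, the length is 6 + 2h = 2p.
    enough : p ≤ suc (length cs)
    enough = ℕ.≤-reflexive (cong (3 ℕ.+_) (sym (length-map fst prs)))

    perm : u ∷ v ∷ concatMap (_∷ []) cs ++ F ++ map snd prs ↭ (u ∷ v ∷ c₁ ∷ c₂ ∷ []) ++ F ++ unpair prs
    perm = ↭-trans (↭-reflexive (cong (λ t → u ∷ v ∷ c₁ ∷ c₂ ∷ t ++ F ++ map snd prs) (concatMap-pure (map fst prs))))
      (++⁺ˡ (u ∷ v ∷ c₁ ∷ c₂ ∷ []) (↭-trans (shifts (map fst prs) F) (++⁺ˡ F (firsts-seconds prs))))

    classSum≡ : classSum ((u ∷ v ∷ c₁ ∷ c₂ ∷ []) ++ F ++ unpair prs) ≡ 0#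
    classSum≡ = trans (classSum-++ (u ∷ v ∷ c₁ ∷ c₂ ∷ []) (F ++ unpair prs))
      (trans (cong (classSum (u ∷ v ∷ c₁ ∷ c₂ ∷ []) ⊕_) (trans (classSum-++ F (unpair prs))
        (trans (cong (classSum F ⊕_) (classSum-pairs prs)) (⊕-identityʳ (classSum F))))) cls)

    length≡ : length ((u ∷ v ∷ c₁ ∷ c₂ ∷ []) ++ F ++ unpair prs) ≡ p ℕ.* 2
    length≡ = cong (4 ℕ.+_) (trans (length-++ F) (cong₂ ℕ._+_ lF (length-pairs prs)))

  -- The two reflections of `π` enclose those pairs that are to be inverted. Each of the other p - 1
  -- pairs is a word whose exponent, twice its value, is nonzero modulo p.
  reflection-pair⇒block : ∀ π prs rest {S} → reflection (class (fst π)) ≡ true → suc (length prs) ≡ p →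
    All (λ π → ¬ + p ∣ pairValue π) prs → unpair (π ∷ prs) ++ rest ↭ S → BlockIn p S
  reflection-pair⇒block π prs rest ref l nonzero σ =
    placed (signed-block twoElements pp p∤2 (fst π) (snd π) prs [] ref (trans (cong reflection (sym (same π))) ref)
              (All.universal (λ π → cong isReflection (∏-pair π)) prs)
              (All.map (λ {π} n d → n (halve pp p∤2 _ (∣-resp (cong proj₁ (∏-pair π)) d))) nonzero)
              (ℕ.≤-reflexive (sym l))
              (trans (cong classSum []-identity) (classSum-pairs (π ∷ prs)))
              (trans (cong length []-identity) (trans (length-pairs (π ∷ prs)) (cong (ℕ._* 2) l))))
      (↭-trans (↭-reflexive (cong (_++ rest) []-identity)) σ)
    where
    []-identity : unpair (π ∷ prs) ++ [] ≡ unpair (π ∷ prs)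
    []-identity = ++-identityʳ _

  -- A pair of reflections can enclose the other pairs. If there is none, the enclosing reflections
  -- come from `L`, where classes are distinct, so their classes do not cancel. Two rotations c₁, c₂
  -- without their partners and two fillers restore the class sum. If c₁ and c₂ have equal classes,
  -- the reflections are u, v and the fillers r, r′. Otherwise two reflections whose classes differ
  -- by `class c₁ ⊕ class c₂` are chosen, and a third pair is the filler.
  nonzero-pairs⇒block : ∀ prs → length prs ≡ p → All (λ π → ¬ + p ∣ pairValue π) prs →
    ∀ {L w} → map class L ++ w ∷ [] ↭ classes →
    ∀ r r′ u v R → reflection (class u) ≡ true → reflection (class v) ≡ true →
    classSum (r ∷ r′ ∷ u ∷ v ∷ []) ≡ 0# → (r ∷ r′ ∷ u ∷ v ∷ []) ++ R ↭ L →
    BlockIn p (unpair prs ++ L)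
  nonzero-pairs⇒block prs l nonzero {L} {w} missing r r′ u v R ref-u ref-v cls ρ =
    by-kind (Any.any? (λ π → reflection (class (fst π)) Bool.≟ true) prs)
    where
    Goal = BlockIn p (unpair prs ++ L)

    by-classes : ∀ c₁ d₁ c₂ d₂ c₃ d₃ gs → length gs ≡ h → GoodRotation c₁ → GoodRotation c₂ → class c₃ ≡ class d₃ → All GoodRotations gs →
      (c₁ ∷ d₁ ∷ c₂ ∷ d₂ ∷ c₃ ∷ d₃ ∷ []) ++ unpair gs ↭ unpair prs → Dec (class c₁ ≡ class c₂) → Goal
    by-classes c₁ d₁ c₂ d₂ c₃ d₃ gs lg g₁ g₂ _ good σ (yes e) =
      signed-rotations⇒block u v ref-u ref-v c₁ c₂ g₁ g₂ gs lg good (r ∷ r′ ∷ []) refl cls′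
        (d₁ ∷ d₂ ∷ c₃ ∷ d₃ ∷ R) (begin
          (u ∷ v ∷ c₁ ∷ c₂ ∷ []) ++ (r ∷ r′ ∷ []) ++ G ++ (d₁ ∷ d₂ ∷ c₃ ∷ d₃ ∷ []) ++ R
            ↭⟨ ↭-Solver.solve 10 (λ u v c₁ c₂ rr G d₁ d₂ t R → (u ⊕′ v ⊕′ c₁ ⊕′ c₂) ⊕′ rr ⊕′ G ⊕′ (d₁ ⊕′ d₂ ⊕′ t) ⊕′ R
                 ⊜ ((c₁ ⊕′ d₁ ⊕′ c₂ ⊕′ d₂ ⊕′ t) ⊕′ G) ⊕′ ((rr ⊕′ u ⊕′ v) ⊕′ R)) ↭-refl
                 (u ∷ []) (v ∷ []) (c₁ ∷ []) (c₂ ∷ []) (r ∷ r′ ∷ []) G (d₁ ∷ []) (d₂ ∷ []) (c₃ ∷ d₃ ∷ []) R ⟩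
          ((c₁ ∷ d₁ ∷ c₂ ∷ d₂ ∷ c₃ ∷ d₃ ∷ []) ++ G) ++ ((r ∷ r′ ∷ u ∷ v ∷ []) ++ R)
            ↭⟨ ++⁺ σ ρ ⟩
          unpair prs ++ L ∎)
      where
      open PermutationReasoning
      open ↭-Solver using (_⊜_) renaming (_⊕_ to _⊕′_)
      G = unpair gs
      cls′ : classSum (u ∷ v ∷ c₁ ∷ c₂ ∷ []) ⊕ classSum (r ∷ r′ ∷ []) ≡ 0#
      cls′ = trans (sym (classSum-++ (u ∷ v ∷ c₁ ∷ c₂ ∷ []) (r ∷ r′ ∷ [])))
        (trans (classSum-↭ (↭-Solver.solve 3 (λ uv cc rr → (uv ⊕′ cc) ⊕′ rr ⊜ (rr ⊕′ uv) ⊕′ cc) ↭-refl (u ∷ v ∷ []) (c₁ ∷ c₂ ∷ []) (r ∷ r′ ∷ [])))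
        (trans (classSum-++ (r ∷ r′ ∷ u ∷ v ∷ []) (c₁ ∷ c₂ ∷ [])) (cong₂ _⊕_ cls (classSum-pair (pair c₁ c₂ e)))))
    by-classes c₁ d₁ c₂ d₂ c₃ d₃ gs lg g₁ g₂ e₃ good σ (no c₁≢c₂) =
      difference (reflections-with-difference w (class c₁ ⊕ class c₂) (cong₂ _xor_ (proj₁ g₁) (proj₁ g₂))
        (λ e → c₁≢c₂ (trans (⊕-cancel′ (class c₂) (trans (⊕-comm (class c₂) (class c₁)) e) ) (⊕-identityʳ (class c₂)))))
      where
      open PermutationReasoning
      open ↭-Solver using (_⊜_) renaming (_⊕_ to _⊕′_)
      G = unpair gs
      difference : (∃ λ κ → (AllPairs _≢_ (κ ∷ κ ⊕ (class c₁ ⊕ class c₂) ∷ []) × Avoids (w ∷ []) (κ ∷ κ ⊕ (class c₁ ⊕ class c₂) ∷ []))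
        × reflection κ ≡ true) → Goal
      difference (κ , (distinct , avoids) , ref) = use (pick-classes missing distinct avoids)
        where
        use : (∃₂ λ xs R → xs ++ R ↭ L × map class xs ≡ κ ∷ κ ⊕ (class c₁ ⊕ class c₂) ∷ []) → Goal
        use (u′ ∷ v′ ∷ [] , R′ , τ , e) =
          signed-rotations⇒block u′ v′ (trans (cong reflection eᵤ) ref)
            (trans (cong reflection eᵥ) (cong₂ _xor_ ref (cong₂ _xor_ (proj₁ g₁) (proj₁ g₂))))
            c₁ c₂ g₁ g₂ gs lg good (c₃ ∷ d₃ ∷ []) refl cls′ (d₁ ∷ d₂ ∷ R′) (begin
              (u′ ∷ v′ ∷ c₁ ∷ c₂ ∷ []) ++ (c₃ ∷ d₃ ∷ []) ++ G ++ (d₁ ∷ d₂ ∷ []) ++ R′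
                ↭⟨ ↭-Solver.solve 8 (λ uv c₁ c₂ t G d₁ d₂ R → (uv ⊕′ c₁ ⊕′ c₂) ⊕′ t ⊕′ G ⊕′ (d₁ ⊕′ d₂) ⊕′ R
                     ⊜ ((c₁ ⊕′ d₁ ⊕′ c₂ ⊕′ d₂ ⊕′ t) ⊕′ G) ⊕′ (uv ⊕′ R)) ↭-refl
                     (u′ ∷ v′ ∷ []) (c₁ ∷ []) (c₂ ∷ []) (c₃ ∷ d₃ ∷ []) G (d₁ ∷ []) (d₂ ∷ []) R′ ⟩
              ((c₁ ∷ d₁ ∷ c₂ ∷ d₂ ∷ c₃ ∷ d₃ ∷ []) ++ G) ++ ((u′ ∷ v′ ∷ []) ++ R′)
                ↭⟨ ++⁺ σ τ ⟩
              unpair prs ++ L ∎)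
          where
          eᵤ : class u′ ≡ κ
          eᵤ = ∷-injectiveˡ e
          eᵥ : class v′ ≡ κ ⊕ (class c₁ ⊕ class c₂)
          eᵥ = ∷-injectiveˡ (∷-injectiveʳ e)
          cls′ : classSum (u′ ∷ v′ ∷ c₁ ∷ c₂ ∷ []) ⊕ classSum (c₃ ∷ d₃ ∷ []) ≡ 0#
          cls′ = cong₂ _⊕_
            (trans (cong₂ (λ a b → a ⊕ (b ⊕ (class c₁ ⊕ (class c₂ ⊕ 0#)))) eᵤ eᵥ)
              (trans (cong (λ t → κ ⊕ ((κ ⊕ (class c₁ ⊕ class c₂)) ⊕ (class c₁ ⊕ t))) (⊕-identityʳ (class c₂)))
              (trans (sym (⊕-assoc κ _ _)) (trans (cong (_⊕ (class c₁ ⊕ class c₂)) (⊕-cancel κ _)) (⊕-self (class c₁ ⊕ class c₂))))))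
            (classSum-pair (pair c₃ d₃ e₃))
        use ([] , _ , _ , ())
        use (_ ∷ [] , _ , _ , ())
        use (_ ∷ _ ∷ _ ∷ _ , _ , _ , ())

    from-rotations : ∀ prs′ → unpair prs′ ↭ unpair prs → length prs′ ≡ p → All GoodRotations prs′ → Goal
    from-rotations (pair c₁ d₁ _ ∷ pair c₂ d₂ _ ∷ pair c₃ d₃ e₃ ∷ gs) σ l (g₁ ∷ g₂ ∷ _ ∷ good) =
      by-classes c₁ d₁ c₂ d₂ c₃ d₃ gs (ℕ.suc-injective (ℕ.suc-injective (ℕ.suc-injective l))) g₁ g₂ e₃ good σ (class c₁ ≟ᶜ class c₂)
    from-rotations [] _ () _
    from-rotations (_ ∷ []) _ () _
    from-rotations (_ ∷ _ ∷ []) _ () _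

    by-kind : Dec (Any (λ π → reflection (class (fst π)) ≡ true) prs) → Goal
    by-kind (yes reflections) =
      let π , prs′ , ref , σ = split-off reflections
      in reflection-pair⇒block π prs′ L ref (trans (↭-length σ) l) (All.tail (All-resp-↭ (↭-sym σ) nonzero))
           (++⁺ʳ L (concatMap-↭ twoElements σ))
    by-kind (no rotations) =
      let prs′ , σ , l′ , good = orient prs nonzero (All.map Bool.¬-not (All.¬Any⇒All¬ prs rotations))
      in from-rotations prs′ σ (trans l′ l) good

  -- Either p - 2 = h + 1 pairs have value 0 modulo p and complete the quadruple to a block, or at
  -- most p - 3 do; then p of the at least 2p - 3 pairs have nonzero value.
  zero-quad⇒block : ∀ prs → p ℕ.+ suc h ≤ suc (length prs) → ∀ {L w} → map class L ++ w ∷ [] ↭ classes →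
    ∀ r r′ u v R → reflection (class u) ≡ true → reflection (class v) ≡ true →
    classSum (r ∷ r′ ∷ u ∷ v ∷ []) ≡ 0# → (r ∷ r′ ∷ u ∷ v ∷ []) ++ R ↭ L →
    + p ∣ proj₁ (∏ (r ∷ r′ ∷ u ∷ v ∷ [])) → BlockIn p (unpair prs ++ L)
  zero-quad⇒block prs enough {L} missing r r′ u v R ref-u ref-v cls ρ d =
    by-zeros (dec-partition (λ π → + p ∣? pairValue π) prs)
    where
    q = r ∷ r′ ∷ u ∷ v ∷ []
    by-zeros : (∃₂ λ ys zs → ys ++ zs ↭ prs × All (λ π → + p ∣ pairValue π) ys × All (λ π → ¬ + p ∣ pairValue π) zs) →
      BlockIn p (unpair prs ++ L)
    by-zeros (ys , zs , σ , zeros , nonzeros) with ℕ.≤-<-connex (suc h) (length ys)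
    ... | inj₁ many = pad (splitAt-≤ (suc h) ys many) (block-value q cls)
      where
      pad : (∃₂ λ as bs → as ++ bs ≡ ys × length as ≡ suc h) → (∃ λ k → ∏ q ≡ rotation (+ 2 * k)) → BlockIn p (unpair prs ++ L)
      pad (as , bs , e , l) (k , e′) =
        with-quad⇒block {L = L} q R {k} ρ refl e′ as (bs ++ zs)
          (↭-trans (↭-reflexive (trans (sym (++-assoc as bs zs)) (cong (_++ zs) e))) σ) (cong 2+ l)
          (∣m∣n⇒∣m+n (halve pp p∤2 k (∣-resp (cong proj₁ e′) d))
            (∣-Σ pairValue (All.++⁻ˡ as (subst (All _) (sym e) zeros))))
    ... | inj₂ few = use (splitAt-≤ p zs many)
      where
      many : p ≤ length zs
      many = ℕ.+-cancelʳ-≤ (suc h) p (length zs) (ℕ.≤-trans enough (ℕ.≤-trans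
        (ℕ.≤-reflexive (cong suc (trans (sym (↭-length σ)) (length-++ ys))))
        (ℕ.≤-trans (ℕ.+-monoˡ-≤ (length zs) few) (ℕ.≤-reflexive (ℕ.+-comm (suc h) (length zs))))))
      use : (∃₂ λ as bs → as ++ bs ≡ zs × length as ≡ p) → BlockIn p (unpair prs ++ L)
      use (as , bs , refl , l) = extend (nonzero-pairs⇒block as l (All.++⁻ˡ as nonzeros) missing r r′ u v R ref-u ref-v cls ρ)
        where
        extend : BlockIn p (unpair as ++ L) → BlockIn p (unpair prs ++ L)
        extend (blockIn b rest τ) = blockIn b (rest ++ unpair (ys ++ bs)) (begin
          elements b ++ rest ++ B         ≡⟨ sym (++-assoc (elements b) rest B) ⟩
          (elements b ++ rest) ++ B       ↭⟨ ++⁺ʳ B τ ⟩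
          (unpair as ++ L) ++ B
            ↭⟨ ↭-Solver.solve 3 (λ a l b → (a ⊕′ l) ⊕′ b ⊜ (a ⊕′ b) ⊕′ l) ↭-refl (unpair as) L B ⟩
          (unpair as ++ B) ++ L
            ↭⟨ ++⁺ʳ L (pairs-split {as} {ys ++ bs} (↭-trans (shifts as ys) σ)) ⟩
          unpair prs ++ L ∎)
          where
          open PermutationReasoning
          open ↭-Solver using (_⊜_) renaming (_⊕_ to _⊕′_)
          B = unpair (ys ++ bs)

-- One block of weight p from seven unpaired classes

odd-multiple⇒odd : ∀ {p} → Prime p → ∀ k → + p ∣ + 2 * k + 1ℤ → ¬ + p ∣ + 2
odd-multiple⇒odd {p} pp k d d₂ = p≢1 (ℕ.∣1⇒≡1 (∣⇒∣ᵤ (∣-resp (lem (+ 2 * k)) (∣m∣n⇒∣m+n d (∣m⇒∣-m (∣m⇒∣m*n k d₂))))))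
  where
  lem : ∀ a → (a + 1ℤ) + - a ≡ 1ℤ
  lem = solve-∀
  p≢1 : p ≢ 1
  p≢1 refl = ¬prime[1] pp

module _ {k : ℕ} (pp : Prime (2+ k)) (prs : List Pair) (enough : 2+ k ℕ.+ k ≤ suc (length prs))
         {L : List E} {w : Class} (missing : map class L ++ w ∷ [] ↭ classes) where

  private
    p = 2+ k
    Goal = BlockIn p (unpair prs ++ L)

  -- If none of the three rearrangements changes the value modulo p, then p divides the exponents of
  -- r and r′ and the difference of those of u and v, hence the exponent of the quadruple. As the
  -- exponent of r is odd, so is p.
  quad⇒block : ∀ r r′ u v R → proj₁ (class r) ≡ true →
    map (reflection ∘ class) (r ∷ r′ ∷ u ∷ v ∷ []) ≡ false ∷ false ∷ true ∷ true ∷ [] →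
    classSum (r ∷ r′ ∷ u ∷ v ∷ []) ≡ 0# → (r ∷ r′ ∷ u ∷ v ∷ []) ++ R ↭ L → Goal
  quad⇒block r@(kr , .true , .false , _) r′@(_ , _ , .false , _) u@(_ , _ , .true , _) v@(_ , _ , .true , _) R refl refl cls ρ =
    step₁ (+ p ∣? exponent r)
    where
    q = r ∷ r′ ∷ u ∷ v ∷ []

    shifted : ∀ q′ → q′ ↭ q → ∀ δ → proj₁ (∏ q) - proj₁ (∏ q′) ≡ + 2 * δ → ¬ + p ∣ δ → Goal
    shifted q′ σ = quad-shift⇒block {prs = prs} pp enough q q′ R ρ σ refl cls

    l₁ : ∀ a b c d → (a + (b + (c - (d - 0ℤ)))) - (b + (c - (a + (d - 0ℤ)))) ≡ + 2 * a
    l₁ = solve-∀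
    l₂ : ∀ a b c d → (a + (b + (c - (d - 0ℤ)))) - (a + (c - (b + (d - 0ℤ)))) ≡ + 2 * b
    l₂ = solve-∀
    l₃ : ∀ a b c d → (a + (b + (c - (d - 0ℤ)))) - (a + (b + (d - (c - 0ℤ)))) ≡ + 2 * (c - d)
    l₃ = solve-∀
    l₄ : ∀ a b c d → (a + b) + (c - d) ≡ a + (b + (c - (d - 0ℤ)))
    l₄ = solve-∀

    vanish : ∀ {k} (pp : Prime (2+ k)) → 2+ k ℕ.+ k ≤ suc (length prs) → ¬ + 2+ k ∣ + 2 → + 2+ k ∣ proj₁ (∏ q) →
      BlockIn (2+ k) (unpair prs ++ L)
    vanish {zero}  pp enough p∤2 d = ⊥-elim (p∤2 ∣-refl)
    vanish {suc h} pp enough p∤2 d = OddPrime.zero-quad⇒block pp p∤2 prs enough missing r r′ u v R refl refl cls ρ d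

    step₃ : + p ∣ exponent r → + p ∣ exponent r′ → Dec (+ p ∣ exponent u - exponent v) → Goal
    step₃ d₁ d₂ (no n) = shifted (r ∷ r′ ∷ v ∷ u ∷ []) (prep r (prep r′ (swap v u ↭-refl))) _ (l₃ (exponent r) (exponent r′) (exponent u) (exponent v)) n
    step₃ d₁ d₂ (yes d₃) = vanish pp enough (odd-multiple⇒odd pp kr d₁)
      (∣-resp (l₄ (exponent r) (exponent r′) (exponent u) (exponent v)) (∣m∣n⇒∣m+n (∣m∣n⇒∣m+n d₁ d₂) d₃))

    step₂ : + p ∣ exponent r → Dec (+ p ∣ exponent r′) → Goal
    step₂ d₁ (no n)   = shifted (r ∷ u ∷ r′ ∷ v ∷ []) (prep r (swap u r′ ↭-refl)) _ (l₂ (exponent r) (exponent r′) (exponent u) (exponent v)) n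
    step₂ d₁ (yes d₂) = step₃ d₁ d₂ (+ p ∣? exponent u - exponent v)

    step₁ : Dec (+ p ∣ exponent r) → Goal
    step₁ (no n)   = shifted (r′ ∷ u ∷ r ∷ v ∷ []) (↭-trans (prep r′ (swap u r ↭-refl)) (swap r′ r ↭-refl)) _ (l₁ (exponent r) (exponent r′) (exponent u) (exponent v)) n
    step₁ (yes d₁) = step₂ d₁ (+ p ∣? exponent r′)

  seven-classes⇒block : Goal
  seven-classes⇒block = choose (plane-with-odd-rotation w)
    where
    choose : _ → Goal
    choose (κ , μ , ν , ((distinct , sum≡) , avoids) , odd , refs) = use (pick-classes missing distinct avoids)
      where
      use : (∃₂ λ xs R → xs ++ R ↭ L × map class xs ≡ plane κ μ ν) → Goal
      use (r ∷ r′ ∷ u ∷ v ∷ [] , R , σ , e) = quad⇒block r r′ u v R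
        (trans (cong proj₁ (∷-injectiveˡ e)) odd)
        (trans (map-∘ {g = reflection} {f = class} (r ∷ r′ ∷ u ∷ v ∷ [])) (trans (cong (map reflection) e) refs))
        (trans (classSum-map (r ∷ r′ ∷ u ∷ v ∷ [])) (trans (cong sumClasses e) sum≡)) σ
      use ([] , _ , _ , ())
      use (_ ∷ [] , _ , _ , ())
      use (_ ∷ _ ∷ [] , _ , _ , ())
      use (_ ∷ _ ∷ _ ∷ [] , _ , _ , ())
      use (_ ∷ _ ∷ _ ∷ _ ∷ _ ∷ _ , _ , _ , ())

-- From pairs and blocks to a solution

group⇒block : ∀ {d} → Group pairValue d → Block d
group⇒block (group prs r l e) = block-of-pairs₀ prs l (divides r e)

flatten-groups : ∀ {d} (gs : List (Group pairValue d)) → flatten (map group⇒block gs) ≡ unpair (gather gs)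
flatten-groups gs = trans (concatMap-map elements group⇒block gs) (concatMap-concatMap twoElements members gs)

few-classes⇒solution : ∀ {m} .{{_ : ℕ.NonZero m}} prs L {S} → unpair prs ++ L ↭ S → 5 ℕ.* m ≤ suc (length prs) → Solution m S
few-classes⇒solution {m} prs L {S} σ h = assemble (extract (EGZ-theorem m) 4 pairValue prs h)
  where
  assemble : Extraction pairValue m 4 prs → Solution m S
  assemble (extraction gs rest τ c) = solution-from-blocks₀ (map group⇒block gs) (trans (length-map group⇒block gs) c)
    (unpair rest ++ L)
    (↭-trans (↭-reflexive (trans (cong (_++ unpair rest ++ L) (flatten-groups gs))
       (sym (++-assoc (unpair (gather gs)) _ L))))
     (↭-trans (++⁺ʳ L (pairs-split {gather gs} {rest} τ)) σ))

-- Three blocks use 3m of the 5m - 2 pairs. The other 2m - 2 and the quadruple are the weighted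
-- situation, which supplies the fourth block. If it takes everything, the outcome has weight 2m and
-- counts as two blocks, so one of the three goes back to the remainder.
five-classes⇒solution : ∀ {m} .{{_ : ℕ.NonZero m}} prs q R {S} → length q ≡ 4 → classSum q ≡ 0# →
  unpair prs ++ q ++ R ↭ S → 2 ℕ.+ length prs ≡ 5 ℕ.* m → Solution m S
five-classes⇒solution {m@(suc m-1)} prs q R {S} lq cls σ l = assemble (extract (EGZ-theorem m) 3 pairValue prs enough) (block-value q cls)
  where
  enough : 4 ℕ.* m ≤ suc (length prs)
  enough = ℕ.+-cancelˡ-≤ 1 _ _ (subst (1 ℕ.+ 4 ℕ.* m ≤_) (trans (lem m) (sym l)) (ℕ.+-monoˡ-≤ (4 ℕ.* m) (s≤s z≤n)))
    where
    lem : ∀ m → m ℕ.+ 4 ℕ.* m ≡ 5 ℕ.* m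
    lem = ℕ-solve-∀

  assemble : Extraction pairValue m 3 prs → (∃ λ k → ∏ q ≡ rotation (+ 2 * k)) → Solution m S
  assemble (extraction [] _ _ ()) _
  assemble (extraction (_ ∷ []) _ _ ()) _
  assemble (extraction (_ ∷ _ ∷ []) _ _ ()) _
  assemble (extraction (_ ∷ _ ∷ _ ∷ _ ∷ _) _ _ ()) _
  assemble ex@(extraction gs@(g₁ ∷ g₂ ∷ g₃ ∷ []) rest τ refl) (k , e) = cases (WeightedEGZ-theorem m pairValue k rest length-rest)
    where
    open PermutationReasoning
    open ↭-Solver using (_⊜_) renaming (_⊕_ to _⊕′_)

    length-rest : 2 ℕ.+ length rest ≡ m ℕ.+ m
    length-rest = ℕ.+-cancelˡ-≡ (3 ℕ.* m) _ _ (trans (lem (3 ℕ.* m) (length rest))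
      (trans (cong 2+ (Extraction.length-rest ex)) (trans l (lem₂ m))))
      where
      lem : ∀ a b → a ℕ.+ (2 ℕ.+ b) ≡ 2 ℕ.+ (a ℕ.+ b)
      lem = ℕ-solve-∀
      lem₂ : ∀ m → 5 ℕ.* m ≡ 3 ℕ.* m ℕ.+ (m ℕ.+ m)
      lem₂ = ℕ-solve-∀

    all-used : ∀ gs′ → gs′ ≡ gs → flatten (map group⇒block gs′) ++ unpair rest ++ q ++ R ↭ S
    all-used gs′ refl = begin
      flatten (map group⇒block gs) ++ unpair rest ++ q ++ R
        ≡⟨ trans (cong (_++ unpair rest ++ q ++ R) (flatten-groups gs)) (sym (++-assoc (unpair (gather gs)) _ _)) ⟩
      (unpair (gather gs) ++ unpair rest) ++ q ++ R
        ↭⟨ ++⁺ʳ (q ++ R) (pairs-split {gather gs} {rest} τ) ⟩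
      unpair prs ++ q ++ R
        ↭⟨ σ ⟩
      S ∎

    cases : Weighted m pairValue k rest → Solution m S
    cases (without (ys , zs , ρ , ly , d)) =
      solution-from-blocks₀ (block-of-pairs₀ ys ly d ∷ map group⇒block gs) refl (unpair zs ++ q ++ R) (begin
        (unpair ys ++ G) ++ unpair zs ++ q ++ R
          ↭⟨ ↭-Solver.solve 4 (λ y g z r → (y ⊕′ g) ⊕′ z ⊕′ r ⊜ g ⊕′ (y ⊕′ z) ⊕′ r) ↭-refl (unpair ys) G (unpair zs) (q ++ R) ⟩
        G ++ (unpair ys ++ unpair zs) ++ q ++ R
          ↭⟨ ++⁺ˡ G (++⁺ʳ (q ++ R) (pairs-split {ys} {zs} ρ)) ⟩
        G ++ unpair rest ++ q ++ R
          ↭⟨ all-used gs refl ⟩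
        S ∎)
      where G = flatten (map group⇒block gs)
    cases (with-q ys zs ρ ly d) =
      solution-from-blocks₀ (block-of-pairs q 2 lq e ys ly d ∷ map group⇒block gs) refl (unpair zs ++ R) (begin
        ((q ++ unpair ys) ++ G) ++ unpair zs ++ R
          ↭⟨ ↭-Solver.solve 5 (λ q y g z r → ((q ⊕′ y) ⊕′ g) ⊕′ z ⊕′ r ⊜ g ⊕′ (y ⊕′ z) ⊕′ q ⊕′ r) ↭-refl q (unpair ys) G (unpair zs) R ⟩
        G ++ (unpair ys ++ unpair zs) ++ q ++ R
          ↭⟨ ++⁺ˡ G (++⁺ʳ (q ++ R) (pairs-split {ys} {zs} ρ)) ⟩
        G ++ unpair rest ++ q ++ R
          ↭⟨ all-used gs refl ⟩
        S ∎)
      where G = flatten (map group⇒block gs)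
    cases (everything (divides r e′)) =
      solution-from-blocks (q ++ unpair rest) 2 {r} size≡
        (trans (∏-++ q (unpair rest)) (trans (cong₂ _∗_ e (∏-pairs rest)) (cong rotation (trans (lem k (Σ[ pairValue ] rest)) (cong (+ 2 *_) e′)))))
        (map group⇒block (g₁ ∷ g₂ ∷ [])) refl (elements (group⇒block g₃) ++ R) (begin
        (q ++ unpair rest) ++ (G₁ ++ G₂ ++ []) ++ G₃ ++ R
          ↭⟨ ↭-Solver.solve 6 (λ q y a b c r → (q ⊕′ y) ⊕′ (a ⊕′ b ⊕′ id) ⊕′ c ⊕′ r ⊜ (a ⊕′ b ⊕′ c ⊕′ id) ⊕′ y ⊕′ q ⊕′ r) ↭-refl q (unpair rest) G₁ G₂ G₃ R ⟩
        (G₁ ++ G₂ ++ G₃ ++ []) ++ unpair rest ++ q ++ R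
          ↭⟨ all-used gs refl ⟩
        S ∎)
      where
      open ↭-Solver using (id)
      G₁ = elements (group⇒block g₁)
      G₂ = elements (group⇒block g₂)
      G₃ = elements (group⇒block g₃)
      lem : ∀ a b → + 2 * a + + 2 * b ≡ + 2 * (a + b)
      lem = solve-∀
      size≡ : length (q ++ unpair rest) ≡ 2 ℕ.* (m ℕ.* 2)
      size≡ = trans (length-++ q) (trans (cong₂ ℕ._+_ lq (length-pairs rest)) (trans (lem₂ (length rest)) (trans (cong (ℕ._* 2) length-rest) (lem₃ m))))
        where
        lem₂ : ∀ x → 4 ℕ.+ x ℕ.* 2 ≡ (2 ℕ.+ x) ℕ.* 2
        lem₂ = ℕ-solve-∀
        lem₃ : ∀ x → (x ℕ.+ x) ℕ.* 2 ≡ 2 ℕ.* (x ℕ.* 2)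
        lem₃ = ℕ-solve-∀

-- With m = (j + 1) p there are 5m - 3 pairs. EGZ in C_p takes 5j + 3 blocks and leaves 2p - 3
-- pairs, just enough to form one more block with the help of `L`. The total 5j + 4 = 5(j + 1) - 1
-- is what EGZ in C_(j+1) needs for four groups.
seven-classes⇒solution : ∀ {p j} → Prime p → ∀ prs L {w S} → map class L ++ w ∷ [] ↭ classes →
  unpair prs ++ L ↭ S → 3 ℕ.+ length prs ≡ 5 ℕ.* (suc j ℕ.* p) → Solution (suc j ℕ.* p) S
seven-classes⇒solution {zero} pp = ⊥-elim (¬prime[0] pp)
seven-classes⇒solution {suc zero} pp = ⊥-elim (¬prime[1] pp)
seven-classes⇒solution {p@(2+ k)} {j} pp prs L {w} {S} missing σ l = assemble (extract (EGZ-prime pp) (3 ℕ.+ j ℕ.* 5) pairValue prs enough)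
  where
  enough : (4 ℕ.+ j ℕ.* 5) ℕ.* p ≤ suc (length prs)
  enough = ℕ.+-cancelˡ-≤ 2 _ _ (subst (2 ℕ.+ (4 ℕ.+ j ℕ.* 5) ℕ.* p ≤_) (trans (lem j p) (sym l))
    (ℕ.+-monoˡ-≤ ((4 ℕ.+ j ℕ.* 5) ℕ.* p) (s≤s (s≤s z≤n))))
    where
    lem : ∀ j p → p ℕ.+ (4 ℕ.+ j ℕ.* 5) ℕ.* p ≡ 5 ℕ.* (suc j ℕ.* p)
    lem = ℕ-solve-∀

  assemble : Extraction pairValue p (3 ℕ.+ j ℕ.* 5) prs → Solution (suc j ℕ.* p) S
  assemble ex@(extraction gs rest τ c) = finish (seven-classes⇒block pp rest (ℕ.≤-reflexive (sym rest-size)) missing)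
    where
    rest-size : suc (length rest) ≡ 2+ k ℕ.+ k
    rest-size = ℕ.suc-injective (ℕ.suc-injective (ℕ.+-cancelˡ-≡ ((3 ℕ.+ j ℕ.* 5) ℕ.* p) _ _ (trans (lem ((3 ℕ.+ j ℕ.* 5) ℕ.* p) (length rest))
      (trans (cong (3 ℕ.+_) (Extraction.length-rest ex)) (trans l (lem₂ j k))))))
      where
      lem : ∀ a b → a ℕ.+ (3 ℕ.+ b) ≡ 3 ℕ.+ (a ℕ.+ b)
      lem = ℕ-solve-∀
      lem₂ : ∀ j k → 5 ℕ.* (suc j ℕ.* (2 ℕ.+ k)) ≡ (3 ℕ.+ j ℕ.* 5) ℕ.* (2 ℕ.+ k) ℕ.+ (2 ℕ.+ ((2 ℕ.+ k) ℕ.+ k))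
      lem₂ = ℕ-solve-∀

    finish : BlockIn p (unpair rest ++ L) → Solution (suc j ℕ.* p) S
    finish (blockIn b others ρ) = solution-from-many-blocks (b ∷ map group⇒block gs) others perm
      (ℕ.≤-reflexive (trans (ℕ.*-comm 5 (suc j)) (cong 2+ (sym (trans (length-map group⇒block gs) c)))))
      where
      open PermutationReasoning
      open ↭-Solver using (_⊜_) renaming (_⊕_ to _⊕′_)
      G = unpair (gather gs)
      perm : (elements b ++ flatten (map group⇒block gs)) ++ others ↭ S
      perm = begin
        (elements b ++ flatten (map group⇒block gs)) ++ others
          ≡⟨ cong (λ t → (elements b ++ t) ++ others) (flatten-groups gs) ⟩
        (elements b ++ G) ++ others
          ↭⟨ ↭-Solver.solve 3 (λ b g o → (b ⊕′ g) ⊕′ o ⊜ g ⊕′ (b ⊕′ o)) ↭-refl (elements b) G others ⟩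
        G ++ (elements b ++ others)
          ↭⟨ ++⁺ˡ G ρ ⟩
        G ++ (unpair rest ++ L)
          ≡⟨ sym (++-assoc G _ L) ⟩
        (G ++ unpair rest) ++ L
          ↭⟨ ++⁺ʳ L (pairs-split {gather gs} {rest} τ) ⟩
        unpair prs ++ L
          ↭⟨ σ ⟩
        S ∎

factor-prime : ∀ m → 2 ≤ m → ∃₂ λ p j → Prime p × m ≡ suc j ℕ.* p
factor-prime m 2≤m = split (factorise m {{ℕ.>-nonZero (ℕ.≤-trans (s≤s z≤n) 2≤m)}})
  where
  split : PrimeFactorisation m → ∃₂ λ p j → Prime p × m ≡ suc j ℕ.* p
  split record { factors = [] ; isFactorisation = e } = ⊥-elim (ℕ.<⇒≱ 2≤m (ℕ.≤-reflexive e))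
  split record { factors = p ∷ ps ; isFactorisation = e ; factorsPrime = pp ∷ _ } = p , shape (product ps) e
    where
    shape : ∀ n → m ≡ p ℕ.* n → ∃ λ j → Prime p × m ≡ suc j ℕ.* p
    shape zero    e = ⊥-elim (ℕ.<⇒≱ 2≤m (subst (_≤ 1) (sym (trans e (ℕ.*-zeroʳ p))) z≤n))
    shape (suc j) e = j , pp , trans e (ℕ.*-comm p (suc j))

find-solution : ∀ m → 2 ≤ m → ∀ S → length S ≡ suc (10 ℕ.* m) → Solution m S
find-solution m 2≤m S lS = pairing (pair-up S)
  where
  instance
    m≢0 : ℕ.NonZero m
    m≢0 = ℕ.>-nonZero (ℕ.≤-trans (s≤s z≤n) 2≤m)

  pairing : (∃₂ λ prs L → unpair prs ++ L ↭ S × DistinctClasses L) → Solution m S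
  pairing (prs , L , σ , dist) = by-missing (missing-classes L dist)
    where
    count : length prs ℕ.* 2 ℕ.+ length L ≡ suc (10 ℕ.* m)
    count = trans (cong (ℕ._+ length L) (sym (length-pairs prs))) (trans (sym (length-++ (unpair prs))) (trans (↭-length σ) lS))

    length-L : ∀ {M} → map class L ++ M ↭ classes → length L ℕ.+ length M ≡ 8
    length-L {M} ρ = trans (cong (ℕ._+ length M) (sym (length-map class L))) (trans (sym (length-++ (map class L))) (↭-length ρ))

    odd-L : ∀ l → length L ≡ 2 ℕ.* l → Solution m S
    odd-L l e = ⊥-elim (ℕ.even≢odd (length prs ℕ.+ l) (5 ℕ.* m) (trans (lem (length prs) l) (trans (cong (length prs ℕ.* 2 ℕ.+_) (sym e)) (trans count (cong suc (lem₂ m))))))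
      where
      lem : ∀ a b → 2 ℕ.* (a ℕ.+ b) ≡ a ℕ.* 2 ℕ.+ 2 ℕ.* b
      lem = ℕ-solve-∀
      lem₂ : ∀ m → 10 ℕ.* m ≡ 2 ℕ.* (5 ℕ.* m)
      lem₂ = ℕ-solve-∀

    size-L : ∀ {M} → map class L ++ M ↭ classes → ∀ k → length M ℕ.+ k ≡ 8 → length L ≡ k
    size-L {M} ρ k e = ℕ.+-cancelʳ-≡ (length M) _ _ (trans (length-L ρ) (trans (sym e) (ℕ.+-comm (length M) k)))

    count-pairs : ∀ l → length L ≡ suc (2 ℕ.* l) → l ℕ.+ length prs ≡ 5 ℕ.* m
    count-pairs l e = ℕ.*-cancelˡ-≡ _ _ 2 (ℕ.suc-injective (trans (lem (length prs) l)
      (trans (cong (length prs ℕ.* 2 ℕ.+_) (sym e)) (trans count (cong suc (lem₂ m))))))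
      where
      lem : ∀ a b → suc (2 ℕ.* (b ℕ.+ a)) ≡ a ℕ.* 2 ℕ.+ suc (2 ℕ.* b)
      lem = ℕ-solve-∀
      lem₂ : ∀ m → 10 ℕ.* m ≡ 2 ℕ.* (5 ℕ.* m)
      lem₂ = ℕ-solve-∀

    by-missing : (∃ λ M → map class L ++ M ↭ classes) → Solution m S
    by-missing ([] , ρ) = odd-L 4 (size-L ρ 8 refl)
    by-missing (w ∷ [] , ρ) = seven (factor-prime m 2≤m)
      where
      seven : (∃₂ λ p j → Prime p × m ≡ suc j ℕ.* p) → Solution m S
      seven (p , j , pp , e) = subst (λ m → Solution m S) (sym e)
        (seven-classes⇒solution {p} {j} pp prs L ρ σ (trans (count-pairs 3 (size-L ρ 7 refl)) (cong (5 ℕ.*_) e)))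
    by-missing (_ ∷ _ ∷ [] , ρ) = odd-L 3 (size-L ρ 6 refl)
    by-missing (a ∷ b ∷ c ∷ [] , ρ) = quadruple (plane-avoiding-three a b c)
      where
      quadruple : _ → Solution m S
      quadruple (ks , (distinct , sum≡) , lks , avoids) = use (pick-classes ρ distinct avoids)
        where
        use : (∃₂ λ xs R → xs ++ R ↭ L × map class xs ≡ ks) → Solution m S
        use (q , R , τ , e) = five-classes⇒solution prs q R (trans (sym (length-map class q)) (trans (cong length e) lks))
          (trans (classSum-map q) (trans (cong sumClasses e) sum≡))
          (↭-trans (++⁺ˡ (unpair prs) τ) σ) (count-pairs 2 (size-L ρ 5 refl))
    -- A bound of four unpaired elements is enough: 2 (length prs + 2) > 10m already gives at least
    -- 5m - 1 pairs.
    by-missing (_ ∷ _ ∷ _ ∷ _ ∷ M , ρ) = few-classes⇒solution prs L σ (ℕ.≤-pred (ℕ.*-cancelˡ-< 2 _ _ (begin-strict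
      2 ℕ.* (5 ℕ.* m)                 ≡⟨ lem m ⟩
      10 ℕ.* m                        <⟨ ℕ.n<1+n _ ⟩
      suc (10 ℕ.* m)                  ≡⟨ sym count ⟩
      length prs ℕ.* 2 ℕ.+ length L   ≤⟨ ℕ.+-monoʳ-≤ (length prs ℕ.* 2) at-most-4 ⟩
      length prs ℕ.* 2 ℕ.+ 4          ≡⟨ lem₂ (length prs) ⟩
      2 ℕ.* (2 ℕ.+ length prs)        ∎)))
      where
      open ℕ.≤-Reasoning
      lem : ∀ m → 2 ℕ.* (5 ℕ.* m) ≡ 10 ℕ.* m
      lem = ℕ-solve-∀
      lem₂ : ∀ a → a ℕ.* 2 ℕ.+ 4 ≡ 2 ℕ.* (2 ℕ.+ a)
      lem₂ = ℕ-solve-∀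
      at-most-4 : length L ≤ 4
      at-most-4 = ℕ.+-cancelʳ-≤ 4 (length L) 4 (ℕ.≤-trans (ℕ.+-monoʳ-≤ (length L) (ℕ.m≤m+n 4 (length M))) (ℕ.≤-reflexive (length-L ρ)))

-- Transfer to the finite group

⊆-↭ : {T xs ys : List I} → xs ↭ ys → T ⊆ xs → ∃ λ T′ → T′ ⊆ ys × T ↭ T′
⊆-↭ Perm.refl τ = _ , τ , ↭-refl
⊆-↭ (prep x σ) (.x ∷ʳ τ) with ⊆-↭ σ τ
... | T′ , τ′ , ρ = T′ , x ∷ʳ τ′ , ρ
⊆-↭ (prep x σ) (refl ∷ τ) with ⊆-↭ σ τ
... | T′ , τ′ , ρ = x ∷ T′ , refl ∷ τ′ , prep x ρ
⊆-↭ (swap x y σ) (.x ∷ʳ .y ∷ʳ τ) with ⊆-↭ σ τ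
... | T′ , τ′ , ρ = T′ , y ∷ʳ x ∷ʳ τ′ , ρ
⊆-↭ (swap x y σ) (.x ∷ʳ (refl ∷ τ)) with ⊆-↭ σ τ
... | T′ , τ′ , ρ = y ∷ T′ , refl ∷ (x ∷ʳ τ′) , prep y ρ
⊆-↭ (swap x y σ) (refl ∷ (.y ∷ʳ τ)) with ⊆-↭ σ τ
... | T′ , τ′ , ρ = x ∷ T′ , y ∷ʳ (refl ∷ τ′) , prep x ρ
⊆-↭ (swap x y σ) (refl ∷ (refl ∷ τ)) with ⊆-↭ σ τ
... | T′ , τ′ , ρ = y ∷ x ∷ T′ , refl ∷ (refl ∷ τ′) , swap x y ρ
⊆-↭ (Perm.trans σ₁ σ₂) τ with ⊆-↭ σ₁ τ
... | T₁ , τ₁ , ρ₁ with ⊆-↭ σ₂ τ₁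
...   | T₂ , τ₂ , ρ₂ = T₂ , τ₂ , ↭-trans ρ₁ ρ₂

⊆-++-split : ∀ {T : List I} xs {ys} → T ⊆ xs ++ ys → ∃₂ λ T₁ T₂ → T ≡ T₁ ++ T₂ × T₁ ⊆ xs × T₂ ⊆ ys
⊆-++-split []       τ = [] , _ , refl , [] , τ
⊆-++-split (x ∷ xs) (.x ∷ʳ τ) with ⊆-++-split xs τ
... | T₁ , T₂ , e , τ₁ , τ₂ = T₁ , T₂ , e , x ∷ʳ τ₁ , τ₂
⊆-++-split (x ∷ xs) (refl ∷ τ) with ⊆-++-split xs τ
... | T₁ , T₂ , refl , τ₁ , τ₂ = x ∷ T₁ , T₂ , refl , refl ∷ τ₁ , τ₂

halves : ∀ t → ∃₂ λ k i → + t ≡ + 2 * k + bit i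
halves zero          = 0ℤ , false , refl
halves (suc zero)    = 0ℤ , true , refl
halves (suc (suc t)) with halves t
... | k , i , e = 1ℤ + k , i , trans (cong (_+_ (+ 2)) e) (lem k (bit i))
  where
  lem : ∀ k b → + 2 + (+ 2 * k + b) ≡ + 2 * (1ℤ + k) + b
  lem = solve-∀

module _ (n : ℕ) .{{_ : ℕ.NonZero n}} where

  open Dihedral n hiding (_⊕_)

  residue-self : ∀ z → + toℕ (residue {n} z) ≈ z [ n ]
  residue-self z = congruent (divides (- (z /ℕ n)) (begin
      + toℕ (residue {n} z) - z
    ≡⟨ cong₂ (λ r z → + r - z) (Fin.toℕ-fromℕ< (n%ℕd<d z n)) (a≡a%ℕn+[a/ℕn]*n z n) ⟩
      + (z %ℕ n) - (+ (z %ℕ n) + (z /ℕ n) * + n)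
    ≡⟨ lem (+ (z %ℕ n)) (z /ℕ n) (+ n) ⟩
      (- (z /ℕ n)) * + n ∎))
    where
    open ≡-Reasoning
    lem : ∀ r q n → r - (r + q * n) ≡ (- q) * n
    lem = solve-∀

  small-≈⇒≡ : ∀ {i j} → i < n → j < n → + i ≈ + j [ n ] → i ≡ j
  small-≈⇒≡ {i} {j} i<n j<n e = ℕ.≤-antisym (no-gap i j i<n e) (no-gap j i j<n (≈-sym e))
    where
    no-gap : ∀ i j → i < n → + i ≈ + j [ n ] → i ≤ j
    no-gap i j i<n (congruent d) = ℕ.≮⇒≥ λ j<i → ∤-small (i ℕ.∸ j) (ℕ.m<n⇒0<n∸m j<i) (ℕ.≤-<-trans (ℕ.m∸n≤m i j) i<n)
      (∣-resp (trans (ℤ.m-n≡m⊖n i j) (ℤ.⊖-≥ (ℕ.<⇒≤ j<i))) d)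

  residue-cong : ∀ {x y} → x ≈ y [ n ] → residue {n} x ≡ residue y
  residue-cong {x} {y} e = Fin.toℕ-injective (small-≈⇒≡ (Fin.toℕ<n _) (Fin.toℕ<n _)
    (≈-trans (residue-self x) (≈-trans e (≈-sym (residue-self y)))))

  residue-toℕ : ∀ (a : Fin n) → residue (+ toℕ a) ≡ a
  residue-toℕ a = Fin.toℕ-injective (trans (Fin.toℕ-fromℕ< (n%ℕd<d (+ toℕ a) n)) (ℕ.m<n⇒m%n≡m (Fin.toℕ<n a)))

  φ : D → G
  φ (a , s , c) = residue a , s , c

  φ-∗ : ∀ x y → φ (x ∗ y) ≡ φ x · φ y
  φ-∗ (a , false , c) (b , t , d) = cong (_, t , c xor d) (residue-cong (≈-sym
    (≈-trans (≈-reflexive (ℤ.pos-+ (toℕ (residue {n} a)) (toℕ (residue {n} b)))) (+-cong-≈ (residue-self a) (residue-self b)))))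
  φ-∗ (a , true , c) (b , t , d) = cong (_, not t , c xor d) (residue-cong (≈-sym
    (≈-trans (≈-reflexive (ℤ.pos-+ (toℕ (residue {n} a)) (toℕ (⊖ residue {n} b)))) (+-cong-≈ (residue-self a)
      (≈-trans (residue-self (+ (n ℕ.∸ toℕ (residue {n} b)))) minus)))))
    where
    r = toℕ (residue {n} b)
    minus : + (n ℕ.∸ r) ≈ - b [ n ]
    minus = ≈-trans (≈-reflexive (trans (sym (ℤ.⊖-≥ (ℕ.<⇒≤ (Fin.toℕ<n (residue {n} b))))) (sym (ℤ.m-n≡m⊖n n r))))
      (congruent (∣-resp (lem (+ n) (+ r) b) (∣m∣n⇒∣m+n ∣-refl (∣m⇒∣-m (∣-diff (residue-self b))))))
      where
      lem : ∀ n r b → n + - (r - b) ≡ (n - r) - - b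
      lem = solve-∀

  -- The exponent is lifted to its representative among 0, ..., n - 1; its parity then determines
  -- the class.
  lift : G → E
  lift (a , s , c) = let k , i , _ = halves (toℕ a) in k , i , s , c

  image : E → G
  image x = φ ⟦ x ⟧

  image-lift : ∀ g → image (lift g) ≡ g
  image-lift (a , s , c) = cong (_, s , c) (trans (cong residue (sym (proj₂ (proj₂ (halves (toℕ a)))))) (residue-toℕ a))

  prod-image : ∀ xs → prod (map image xs) ≡ φ (∏ xs)
  prod-image []       = refl
  prod-image (x ∷ xs) = trans (cong (image x ·_) (prod-image xs)) (sym (φ-∗ ⟦ x ⟧ (∏ xs)))

  map-image-lift : ∀ S → map image (map lift S) ≡ S
  map-image-lift S = trans (sym (map-∘ S)) (trans (map-cong image-lift S) (map-id S))

  -- Here n = 2m enters: the exponent 2 r m of the chosen product is r n, and its length 8m is 4n,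
  -- the order of the group. `S′` holds the surplus beyond the part that was searched.
  solution⇒product-one : ∀ {m} → n ≡ 2 ℕ.* m → ∀ S S′ → Solution m (map lift S) →
    ∃ λ T → T ⊆ S ++ S′ × length T ≡ 4 ℕ.* n × OneInπ T
  solution⇒product-one {m} n≡ S S′ (solution U R σ l r e) =
    let T , τ , ρ = ⊆-↭ perm (Sublist.++⁺ʳ (map image R ++ S′) ⊆-refl)
    in T , τ , trans (sym (↭-length ρ)) length≡ , map image U , ρ , prod≡
    where
    perm : map image U ++ (map image R ++ S′) ↭ S ++ S′
    perm = ↭-trans (↭-reflexive (trans (sym (++-assoc (map image U) _ S′)) (cong (_++ S′) (sym (map-++ image U R)))))
      (++⁺ʳ S′ (↭-trans (map⁺ image σ) (↭-reflexive (map-image-lift S))))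
    length≡ : length (map image U) ≡ 4 ℕ.* n
    length≡ = trans (length-map image U) (trans l (cong (4 ℕ.*_) (trans (ℕ.*-comm m 2) (sym n≡))))
    prod≡ : prod (map image U) ≡ Dihedral.e n
    prod≡ = trans (prod-image U) (trans (cong φ e) (cong (_, false , false) (residue-cong {+ 2 * (r * + m)} {0ℤ} (congruent (divides r multiple)))))
      where
      lem : ∀ r m → + 2 * (r * m) - 0ℤ ≡ r * (+ 2 * m)
      lem = solve-∀
      multiple : + 2 * (r * + m) - 0ℤ ≡ r * + n
      multiple = trans (lem r (+ m)) (cong (r *_) (trans (sym (ℤ.pos-* 2 m)) (cong +_ (sym n≡))))

  -- Product-one free sequences and the lower bound

  identityˡ : ∀ g → Dihedral.e n · g ≡ g
  identityˡ (a , s , c) = cong (_, s , c) (trans (cong (λ t → mod (t ℕ.+ toℕ a)) toℕ-0) (residue-toℕ a))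
    where
    toℕ-0 : toℕ (mod 0) ≡ 0
    toℕ-0 = trans (Fin.toℕ-fromℕ< _) (ℕ.m<n⇒m%n≡m (ℕ.>-nonZero⁻¹ n))

  prod-drop-e : ∀ as bs → prod (as ++ Dihedral.e n ∷ bs) ≡ prod (as ++ bs)
  prod-drop-e []       bs = identityˡ _
  prod-drop-e (a ∷ as) bs = cong (a ·_) (prod-drop-e as bs)

  remove-e : ∀ {T X} → T ↭ Dihedral.e n ∷ X → ∃ λ Y → Y ↭ X × prod Y ≡ prod T
  remove-e {T} {X} σ with ∈-∃++ (∈-resp-↭ (↭-sym σ) (here refl))
  ... | as , bs , refl = as ++ bs , drop-∷ (↭-trans (↭-sym (shift _ as bs)) σ) , sym (prod-drop-e as bs)

  remove-es : ∀ {T} X es → All (_≡ Dihedral.e n) es → T ↭ X ++ es → ∃ λ Y → Y ↭ X × prod Y ≡ prod T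
  remove-es X []       []           σ = _ , ↭-trans σ (↭-reflexive (++-identityʳ X)) , refl
  remove-es X (_ ∷ es) (refl ∷ all) σ with remove-e (↭-trans σ (shift _ X es))
  ... | Y , ρ , e₁ with remove-es X es all ρ
  ...   | Z , ρ′ , e₂ = Z , ρ′ , trans e₂ e₁

  -- Append 4n - 1 copies of the identity to a product-one free sequence.
  free-length : ∀ {ℓ} → EProp (4 ℕ.* n) ℓ → ∀ S → ProductOneFree S → length S ℕ.+ 4 ℕ.* n ≤ ℓ
  free-length {ℓ} E S free = ℕ.≮⇒≥ λ short → contradict (E padded (ℕ.≤-pred (ℕ.≤-trans short (ℕ.≤-reflexive (sym length-padded)))))
    where
    -- One identity short of 4n, so a subsequence of length 4n must contain an element of `S`.
    N = ℕ.pred (4 ℕ.* n)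
    suc-N : suc N ≡ 4 ℕ.* n
    suc-N = ℕ.suc-pred (4 ℕ.* n) {{ℕ.m*n≢0 4 n}}
    padded = S ++ replicate N (Dihedral.e n)
    length-padded : suc (length padded) ≡ length S ℕ.+ 4 ℕ.* n
    length-padded = trans (cong suc (trans (length-++ S) (cong (length S ℕ.+_) (length-replicate N))))
      (trans (sym (ℕ.+-suc (length S) N)) (cong (length S ℕ.+_) suc-N))
    contradict : ¬ ∃ λ T → T ⊆ padded × length T ≡ 4 ℕ.* n × OneInπ T
    contradict (T , τ , l , T′ , σ , one) with ⊆-++-split S τ
    ... | T₁ , T₂ , refl , τ₁ , τ₂ with remove-es T₁ T₂ (All-resp-⊆ τ₂ (All.replicate⁺ N refl)) σ
    ...   | Y , ρ , e = free (T₁ , τ₁ , nonempty , Y , ρ , trans e one)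
      where
      nonempty : 1 ≤ length T₁
      nonempty = ℕ.+-cancelʳ-≤ N 1 (length T₁) (ℕ.≤-trans (ℕ.≤-reflexive (trans suc-N (trans (sym l) (length-++ T₁))))
        (ℕ.+-monoʳ-≤ (length T₁) (subst (length T₂ ≤_) (length-replicate N) (length-mono-≤ τ₂))))

  x̂ ŷ ẑ : G
  x̂ = φ (1ℤ , false , false)
  ŷ = φ (0ℤ , true , false)
  ẑ = φ (0ℤ , false , true)

  extremal : List G
  extremal = ŷ ∷ ẑ ∷ replicate (ℕ.pred n) x̂

  -- Keeps only the two C₂-components, encoded in `E` so that `classSum-↭` shows their sum to be
  -- independent of the order.
  flags : G → E
  flags (_ , s , c) = 0ℤ , false , s , c

  prod-flags : ∀ xs → proj₂ (prod xs) ≡ proj₂ (classSum (map flags xs))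
  prod-flags []       = refl
  prod-flags (x ∷ xs) = cong (λ κ → proj₁ (proj₂ x) xor proj₁ κ , proj₂ (proj₂ x) xor proj₂ κ) (prod-flags xs)

  flags-xs : ∀ {T} → All (_≡ x̂) T → classSum (map flags T) ≡ 0#
  flags-xs []           = refl
  flags-xs (refl ∷ all) = cong (0# ⊕_) (flags-xs all)

  prod-xs : ∀ {T} → All (_≡ x̂) T → prod T ≡ φ (rotation (+ length T))
  prod-xs []                       = refl
  prod-xs {x ∷ T} (refl ∷ all) = trans (cong (x̂ ·_) (prod-xs all)) (sym (φ-∗ (1ℤ , false , false) (rotation (+ length T))))

  -- An odd number of ŷ or ẑ shows in the C₂-components of the product.
  extremal-free : ProductOneFree extremal
  extremal-free (T , τ , nonempty , T′ , σ , one) = by-shape τ (λ κ≡ → trans (trans (sym κ≡) (cong proj₂ (sym (classSum-↭ (map⁺ flags σ))))) (trans (sym (prod-flags T′)) (cong proj₂ one)))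
    where
    xs : ∀ {U} → U ⊆ replicate (ℕ.pred n) x̂ → All (_≡ x̂) U
    xs υ = All-resp-⊆ υ (All.replicate⁺ (ℕ.pred n) refl)

    by-shape : T ⊆ extremal → (∀ {κ} → proj₂ (classSum (map flags T)) ≡ κ → κ ≡ (false , false)) → ⊥
    by-shape (refl ∷ (refl ∷ υ)) f = case f (cong (λ κ → proj₂ ((false , true , false) ⊕ (false , false , true) ⊕ κ)) (flags-xs (xs υ))) of λ ()
    by-shape (refl ∷ (_ ∷ʳ υ))   f = case f (cong (λ κ → proj₂ ((false , true , false) ⊕ κ)) (flags-xs (xs υ))) of λ ()
    by-shape (_ ∷ʳ (refl ∷ υ))   f = case f (cong (λ κ → proj₂ ((false , false , true) ⊕ κ)) (flags-xs (xs υ))) of λ ()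
    -- Only copies of `x̂` are left. The exponent of their product is the length of `T`, strictly
    -- between 0 and n.
    by-shape (_ ∷ʳ (_ ∷ʳ υ))     f = ∤-small (length T) nonempty short
        (∣-resp (ℤ.+-identityʳ _) (∣-diff (residue-≈ {n} {+ length T} {0ℤ} (cong proj₁ (trans (cong (λ l → φ (rotation (+ l))) (sym (↭-length σ)))
          (trans (sym (prod-xs (All-resp-↭ (↭-sym σ) (xs υ)))) one))))))
      where
      short : length T < n
      short = ℕ.≤-trans (s≤s (subst (length T ≤_) (length-replicate (ℕ.pred n)) (length-mono-≤ υ))) (ℕ.≤-reflexive (ℕ.suc-pred n))

  length-extremal : length extremal ≡ n ℕ.+ 1
  length-extremal = trans (cong 2+ (length-replicate (ℕ.pred n))) (trans (cong suc (ℕ.suc-pred n)) (ℕ.+-comm 1 n))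

-- The values of E and d

E-upper-bound : (n : ℕ) .{{_ : ℕ.NonZero n}} → 4 ≤ n → 2 ℕ.∣ n → Dihedral.EProp n (4 ℕ.* n) (5 ℕ.* n ℕ.+ 1)
E-upper-bound n 4≤n (ℕ.divides m n≡) S h = split (splitAt-≤ (suc (10 ℕ.* m)) S (subst (_≤ length S) size≡ h))
  where
  n≡′ : n ≡ 2 ℕ.* m
  n≡′ = trans n≡ (ℕ.*-comm m 2)

  size≡ : 5 ℕ.* n ℕ.+ 1 ≡ suc (10 ℕ.* m)
  size≡ = trans (cong (λ k → 5 ℕ.* k ℕ.+ 1) n≡) (lem m)
    where
    lem : ∀ m → 5 ℕ.* (m ℕ.* 2) ℕ.+ 1 ≡ suc (10 ℕ.* m)
    lem = ℕ-solve-∀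

  2≤m : 2 ≤ m
  2≤m = ℕ.*-cancelʳ-≤ 2 m 2 (subst (4 ≤_) n≡ 4≤n)

  split : (∃₂ λ S₁ S₂ → S₁ ++ S₂ ≡ S × length S₁ ≡ suc (10 ℕ.* m)) →
    ∃ λ T → T ⊆ S × length T ≡ 4 ℕ.* n × Dihedral.OneInπ n T
  split (S₁ , S₂ , refl , l) = solution⇒product-one n n≡′ S₁ S₂
    (find-solution m 2≤m (map (lift n) S₁) (trans (length-map (lift n) S₁) l))

theorem4p2 : (n : ℕ) .{{_ : ℕ.NonZero n}} → 4 ≤ n → 2 ℕ.∣ n →
    Dihedral.IsE n (4 ℕ.* n) (5 ℕ.* n ℕ.+ 1) × Dihedral.IsD n (n ℕ.+ 1)
theorem4p2 n 4≤n 2∣n =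
    -- `free-length` serves twice: with the extremal sequence it bounds every admissible length for
    -- E from below, and with the upper bound 5n + 1 it limits every free sequence to length n + 1.
    (ℕ.m≤n+m 1 (5 ℕ.* n) , upper , λ m _ E → ℕ.≤-trans (ℕ.≤-reflexive (trans (lem n) (cong (ℕ._+ 4 ℕ.* n) (sym (length-extremal n))))) (free-length n E (extremal n) (extremal-free n)))
  , ((extremal n , extremal-free n , length-extremal n)
    , λ S free → ℕ.+-cancelʳ-≤ (4 ℕ.* n) (length S) (n ℕ.+ 1) (ℕ.≤-trans (free-length n upper S free) (ℕ.≤-reflexive (lem n))))
  where
  upper : Dihedral.EProp n (4 ℕ.* n) (5 ℕ.* n ℕ.+ 1)
  upper = E-upper-bound n 4≤n 2∣n
  lem : ∀ n → 5 ℕ.* n ℕ.+ 1 ≡ (n ℕ.+ 1) ℕ.+ 4 ℕ.* n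
  lem = ℕ-solve-∀
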